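{- Let $b = 2^i 3^j$ with integers $i, j \geq 0$, $i + j > 0$, and $b < 10^{12}$. If $r$ is an integer with $2 \leq r < b$ and $r \mid b$, then $D(b, r) = f(b) + 1$.
   Context: For a positive integer $n$, the complexity $f(n)$ is the least number of $1$'s needed to write $n$ using $1$'s together with an arbitrary number of additions, multiplications and parentheses (e.g. $f(6) \leq 5$ since $6 = (1+1)(1+1+1)$). For integers $b \geq 2$ and $0 \leq r < b$, $D(b, r)$ denotes the smallest integer such that $f(r + bn) \leq f(n) + D(b, r)$ for all positive integers $n$. -}

module Defs where

open import Data.Nat using (ℕ; suc; _+_; _*_; _≤_)
open import Data.Integer as ℤ using (ℤ; +_)
open import Data.Product using (Σ; _×_)
open import Relation.Binary.PropositionalEquality using (_≡_)

data Expr : Set where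
  one : Expr
  add : Expr → Expr → Expr
  mul : Expr → Expr → Expr

value : Expr → ℕ
value one       = 1
value (add e d) = value e + value d
value (mul e d) = value e * value d

ones : Expr → ℕ
ones one       = 1
ones (add e d) = ones e + ones d
ones (mul e d) = ones e + ones d

IsComplexity : ℕ → ℕ → Set
IsComplexity n k =
  Σ Expr (λ e → value e ≡ n × ones e ≡ k) × (∀ (e : Expr) → value e ≡ n → k ≤ ones e)

DBound : ℕ → ℕ → ℤ → Set
DBound b r d = ∀ (n : ℕ) → 1 ≤ n → ∀ (k m : ℕ) →
  IsComplexity (r + b * n) k → IsComplexity n m → (+ k) ℤ.≤ (+ m) ℤ.+ d

IsD : ℕ → ℕ → ℤ → Set
IsD b r d = DBound b r d × (∀ (d' : ℤ) → DBound b r d' → d ℤ.≤ d')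

{-# OPTIONS --safe #-}
module Submission where

-- The upper bound comes from r + b n = r (1 + (b / r) n) and f(2^i 3^j) = 2 i + 3 j.
--
-- The latter rests on value e ^ 3 ≤ 3 ^ ones e, i.e. on the defect δ = ones − 3 log₃ value being nonnegative.  An expression
-- for 2^i 3^J with fewer than 2 i + 3 J ones has small defect (i ≤ 39), its final additions can only add 1, 2 or 3, and
-- what is left is a product equal to 2^i 3^J − w with 1 ≤ w ≤ 3.  Numbers of small defect are classified explicitly, and
-- such a product leads to exponential equations in 2 and 3 without solutions.
--
-- For the lower bound take n = 3^Q with Q huge.  In an expression for N = r + 2^i 3^J with at most 2 i + 3 J ones, drop
-- every summand that is smaller than its partner by a factor M.  Each drop costs defect, so there are boundedly many, and
-- among sufficiently many rapidly growing scales M two consecutive ones drop the same summands.  The pruned value then is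
-- a power of 3 times a number bounded by the first scale and differs from N by a relative error governed by the second;
-- divisibility by a large power of 3 forces it to be 2^i 3^J.  This has complexity 2 i + 3 J, so nothing was dropped and
-- N = 2^i 3^J, a contradiction.

-- The bound `b < 10 ^ 12` enters as `i ≤ 39`, because `2 ^ 40` is larger. The factors 3 have defect
-- 0, so everything is measured on the multiplicative scale 3 ^ δ, where a factor 2 counts 9/8 and
-- the whole budget is (9/8)³⁹ ≈ 98.84. One saved 1 divides the budget by 3 and a summand w that
-- costs w ones divides it by 3 ^ w. This leaves about 10.98, 3.66 and 1.22 for w = 1, 2, 3: the
-- origin of the constants 1099/100, 369/100 and 5/4. The explicit classification reaches only to
-- 83/25, just beyond the limit 3 of the ratios of 3 ^ p + 1, so products must be split before it
-- applies. The lower bound cannot be obtained in this way: an expression for r + 2 ^ i 3 ^ J with 2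
-- i + 3 J ones saves nothing and may use the full budget, far outside the classified range. Hence
-- the argument there is qualitative, with bounds that depend on i but not on J.

open import Defs
open import Data.Nat using (ℕ; zero; suc; _+_; _*_; _^_; _∸_; _≤_; _<_; z≤n; s≤s; NonZero; >-nonZero; _≤?_; _<?_; _≟_)
open import Data.Nat.Properties
open import Data.Nat.Divisibility using (_∣_; divides; _∣?_; ∣m⇒∣m*n; ∣n⇒∣m*n; ∣-refl; ∣-trans; m∣m*n; ∣m∣n⇒∣m+n; ∣m+n∣m⇒∣n)
open import Data.Nat.Primality using (Prime; prime?; euclidsLemma)
open import Data.Nat.Tactic.RingSolver using (solve-∀)
open import Data.Product using (∃; _×_; _,_; proj₁; proj₂)
open import Data.Product.Properties using (≡-dec)
open import Data.Sum using (_⊎_; inj₁; inj₂)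
open import Data.Empty using (⊥)
open import Data.List using (List; []; _∷_)
open import Data.List.Membership.Propositional using (_∈_; find)
open import Data.List.Relation.Unary.Any using (Any; here; any?)
open import Data.List.Relation.Unary.All using (All; all?; lookup)
open import Relation.Nullary using (¬_; Dec; yes; no; contradiction; ¬?)
open import Relation.Nullary.Decidable using (True; toWitness; False; toWitnessFalse; _→-dec_; _×-dec_; _⊎-dec_; map′)
open import Relation.Binary.Definitions using (Tri; tri<; tri≈; tri>)
open import Relation.Binary.PropositionalEquality using (_≡_; _≢_; refl; sym; trans; cong; cong₂; subst; subst₂)
open ≤-Reasoning

-- The defect is nonnegative

opaque
  cube-* : ∀ m n → (m * n) ^ 3 ≡ m ^ 3 * n ^ 3
  cube-* = expand
    where
    expand : ∀ m n → m * n * (m * n * (m * n * 1)) ≡ m * (m * (m * 1)) * (n * (n * (n * 1)))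
    expand = solve-∀

  cube-3^ : ∀ l → (3 ^ l) ^ 3 ≡ 3 ^ (3 * l)
  cube-3^ l = trans (^-*-assoc 3 l 3) (cong (3 ^_) (*-comm l 3))

  3^-cancel-< : ∀ m n → 3 ^ m < 3 ^ n → m < n
  3^-cancel-< m n lt with m <? n
  ... | yes m<n = m<n
  ... | no m≮n  = contradiction (^-monoʳ-≤ 3 (≮⇒≥ m≮n)) (<⇒≱ lt)

  value-pos : ∀ e → 1 ≤ value e
  value-pos one       = ≤-refl
  value-pos (add e d) = ≤-trans (value-pos e) (m≤m+n _ _)
  value-pos (mul e d) = *-mono-≤ (value-pos e) (value-pos d)

  ones-pos : ∀ e → 1 ≤ ones e
  ones-pos one       = ≤-refl
  ones-pos (add e d) = ≤-trans (ones-pos e) (m≤m+n _ _)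
  ones-pos (mul e d) = ≤-trans (ones-pos e) (m≤m+n _ _)

add-wlog : (P : ℕ → ℕ → Set) →
  (∀ e d → value d ≤ value e → P (ones e + ones d) (value e + value d)) →
  ∀ e d → P (ones e + ones d) (value e + value d)
add-wlog P ordered e d with ≤-total (value d) (value e)
... | inj₁ d≤e = ordered e d d≤e
... | inj₂ e≤d = subst₂ P (+-comm (ones d) (ones e)) (+-comm (value d) (value e)) (ordered d e e≤d)

opaque
  -- Once both summands are at least 2, their sum is at most their product, so the only critical
  -- case is the addition of 1.
  cube≤3^ones : ∀ e → value e ^ 3 ≤ 3 ^ ones e
  cube≤3^ones one       = s≤s z≤n
  cube≤3^ones (mul e d) = begin
    (value e * value d) ^ 3       ≡⟨ cube-* (value e) (value d) ⟩
    value e ^ 3 * value d ^ 3     ≤⟨ *-mono-≤ (cube≤3^ones e) (cube≤3^ones d) ⟩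
    3 ^ ones e * 3 ^ ones d       ≡⟨ ^-distribˡ-+-* 3 (ones e) (ones d) ⟨
    3 ^ (ones e + ones d)         ∎
  cube≤3^ones (add e d) =
    sum-bound (ones e) (ones d) (value e) (value d) (cube≤3^ones e) (cube≤3^ones d)
      (ones-pos e) (ones-pos d) (value-pos e) (value-pos d)
    where
    succ-bound : ∀ k u → 1 ≤ k → 1 ≤ u → u ^ 3 ≤ 3 ^ k → (u + 1) ^ 3 ≤ 3 ^ (k + 1)
    succ-bound (suc k) 1 _ _ _ = begin
      8                ≤⟨ toWitness {a? = 8 ≤? 9} _ ⟩
      3 ^ 2            ≤⟨ ^-monoʳ-≤ 3 (s≤s (m≤n+m 1 k)) ⟩
      3 ^ (suc k + 1)  ∎
    succ-bound k 2 _ _ u³≤ = begin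
      3 ^ 3            ≤⟨ ^-monoʳ-≤ 3 (+-monoˡ-≤ 1 (3^-cancel-< 1 k (≤-trans (toWitness {a? = 4 ≤? 8} _) u³≤))) ⟩
      3 ^ (k + 1)      ∎
    -- From u = 3 on, u + 1 ≤ (4/3) u, and (4/3)³ = 64/27 is less than 81/27 = 3, the factor gained
    -- by one more 1.
    succ-bound k u@(suc (suc (suc u'))) _ _ u³≤ = begin
      (u + 1) ^ 3      ≤⟨ *-cancelˡ-≤ 27 (begin
        27 * (u + 1) ^ 3    ≡⟨ cube-* 3 (u + 1) ⟨
        (3 * (u + 1)) ^ 3   ≤⟨ ^-monoˡ-≤ 3 (subst₂ _≤_ (sym (expandˡ u')) (sym (expandʳ u'))
                                 (+-monoʳ-≤ 12 (*-monoˡ-≤ u' (n≤1+n 3)))) ⟩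
        (4 * u) ^ 3         ≡⟨ cube-* 4 u ⟩
        64 * u ^ 3          ≤⟨ *-monoˡ-≤ (u ^ 3) (toWitness {a? = 64 ≤? 81} _) ⟩
        81 * u ^ 3          ≡⟨ *-assoc 27 3 (u ^ 3) ⟩
        27 * (3 * u ^ 3)    ∎) ⟩
      3 * u ^ 3        ≤⟨ *-monoʳ-≤ 3 u³≤ ⟩
      3 ^ suc k        ≡⟨ cong (3 ^_) (+-comm 1 k) ⟩
      3 ^ (k + 1)      ∎
      where
      expandˡ : ∀ x → 3 * (3 + x + 1) ≡ 12 + 3 * x
      expandˡ = solve-∀
      expandʳ : ∀ x → 4 * (3 + x) ≡ 12 + 4 * x
      expandʳ = solve-∀
    sum≤product : ∀ x y → (2 + x) + (2 + y) ≤ (2 + x) * (2 + y)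
    sum≤product x y = subst ((2 + x) + (2 + y) ≤_) (expand x y) (m≤m+n _ _)
      where
      expand : ∀ x y → (2 + x) + (2 + y) + (x + y + x * y) ≡ (2 + x) * (2 + y)
      expand = solve-∀
    sum-bound : ∀ k m u v → u ^ 3 ≤ 3 ^ k → v ^ 3 ≤ 3 ^ m → 1 ≤ k → 1 ≤ m → 1 ≤ u → 1 ≤ v →
      (u + v) ^ 3 ≤ 3 ^ (k + m)
    sum-bound k m u 1 u³≤ _ k≥1 m≥1 u≥1 _ =
      ≤-trans (succ-bound k u k≥1 u≥1 u³≤) (^-monoʳ-≤ 3 (+-monoʳ-≤ k m≥1))
    sum-bound k m 1 v@(suc (suc _)) _ v³≤ k≥1 m≥1 _ v≥1 = begin
      (1 + v) ^ 3      ≡⟨ cong (_^ 3) (+-comm 1 v) ⟩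
      (v + 1) ^ 3      ≤⟨ succ-bound m v m≥1 v≥1 v³≤ ⟩
      3 ^ (m + 1)      ≤⟨ ^-monoʳ-≤ 3 (subst (m + 1 ≤_) (+-comm m k) (+-monoʳ-≤ m k≥1)) ⟩
      3 ^ (k + m)      ∎
    sum-bound k m u@(suc (suc u')) v@(suc (suc v')) u³≤ v³≤ _ _ _ _ = begin
      (u + v) ^ 3      ≤⟨ ^-monoˡ-≤ 3 (sum≤product u' v') ⟩
      (u * v) ^ 3      ≡⟨ cube-* u v ⟩
      u ^ 3 * v ^ 3    ≤⟨ *-mono-≤ u³≤ v³≤ ⟩
      3 ^ k * 3 ^ m    ≡⟨ ^-distribˡ-+-* 3 k m ⟨
      3 ^ (k + m)      ∎

-- Ratio says 3 ^ k / n ^ 3 ≤ C / D and CoRatio says 3 ^ k / n ^ 3 ≥ F / E.  For n = value e and k = ones e the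
-- quotient is 3 ^ δ, where δ = ones e − 3 log₃ (value e) is the defect of e.
record Ratio (C D k n : ℕ) : Set where
  constructor ratio
  field bound : D * 3 ^ k ≤ C * n ^ 3

record CoRatio (E F k n : ℕ) : Set where
  constructor coratio
  field lower : F * n ^ 3 ≤ E * 3 ^ k

open Ratio
open CoRatio

Defect≤ : ℕ → ℕ → Expr → Set
Defect≤ C D e = Ratio C D (ones e) (value e)

cube-nonZero : ∀ {n} → 1 ≤ n → NonZero (n ^ 3)
cube-nonZero {n} n≥1 = m^n≢0 n 3 {{>-nonZero n≥1}}

-- Ratio bounds under products and sums

opaque
  weaken : ∀ {C D k n} C' D' .{{_ : NonZero D}} → C * D' ≤ C' * D → Ratio C D k n → Ratio C' D' k n
  weaken {C} {D} {k} {n} C' D' le (ratio r) = ratio (*-cancelˡ-≤ D (begin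
    D * (D' * 3 ^ k)      ≡⟨ shuffle D D' (3 ^ k) ⟩
    D' * (D * 3 ^ k)      ≤⟨ *-monoʳ-≤ D' r ⟩
    D' * (C * n ^ 3)      ≡⟨ shuffle′ D' C (n ^ 3) ⟩
    C * D' * n ^ 3        ≤⟨ *-monoˡ-≤ (n ^ 3) le ⟩
    C' * D * n ^ 3        ≡⟨ shuffle′ D C' (n ^ 3) ⟨
    D * (C' * n ^ 3)      ∎))
    where
    shuffle : ∀ a b c → a * (b * c) ≡ b * (a * c)
    shuffle = solve-∀
    shuffle′ : ∀ a b c → a * (b * c) ≡ b * a * c
    shuffle′ = solve-∀

  ratio-lower : ∀ {C D k n} → 1 ≤ n → n ^ 3 ≤ 3 ^ k → Ratio C D k n → D ≤ C
  ratio-lower {C} {D} {k} {n} n≥1 n³≤ (ratio r) =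
    *-cancelʳ-≤ D C (n ^ 3) {{cube-nonZero n≥1}} (≤-trans (*-monoʳ-≤ D n³≤) r)

  -- 3 ^ δ is multiplicative, so a factor of ratio at least F / E leaves at most (C / D) (E / F) for
  -- the other factor.
  ratio-quotient : ∀ {C D} k m x y E F → 1 ≤ x → CoRatio E F k x →
    Ratio C D (k + m) (x * y) → Ratio (E * C) (D * F) m y
  ratio-quotient {C} {D} k m x y E F x≥1 (coratio lower) (ratio r) =
    ratio (*-cancelˡ-≤ (x ^ 3) {{cube-nonZero x≥1}} (begin
      x ^ 3 * (D * F * 3 ^ m)        ≡⟨ shuffle₁ (x ^ 3) D F (3 ^ m) ⟩
      D * 3 ^ m * (F * x ^ 3)        ≤⟨ *-monoʳ-≤ (D * 3 ^ m) lower ⟩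
      D * 3 ^ m * (E * 3 ^ k)        ≡⟨ shuffle₂ D (3 ^ m) E (3 ^ k) ⟩
      E * (D * (3 ^ k * 3 ^ m))      ≡⟨ cong (λ z → E * (D * z)) (^-distribˡ-+-* 3 k m) ⟨
      E * (D * 3 ^ (k + m))          ≤⟨ *-monoʳ-≤ E r ⟩
      E * (C * (x * y) ^ 3)          ≡⟨ cong (λ z → E * (C * z)) (cube-* x y) ⟩
      E * (C * (x ^ 3 * y ^ 3))      ≡⟨ shuffle₃ E C (x ^ 3) (y ^ 3) ⟩
      x ^ 3 * (E * C * y ^ 3)        ∎))
    where
    shuffle₁ : ∀ a b c d → a * (b * c * d) ≡ b * d * (c * a)
    shuffle₁ = solve-∀
    shuffle₂ : ∀ a b c d → a * b * (c * d) ≡ c * (a * (d * b))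
    shuffle₂ = solve-∀
    shuffle₃ : ∀ a b c d → a * (b * (c * d)) ≡ c * (a * b * d)
    shuffle₃ = solve-∀

  -- The hypothesis reads C / D ≤ (B / A)²: two factors above B / A would multiply to more than C /
  -- D.
  ratio-split : ∀ {C D} k m x y A B .{{_ : NonZero D}} .{{_ : NonZero B}} → 1 ≤ x →
    C * (A * A) ≤ B * B * D → Ratio C D (k + m) (x * y) → Ratio B A k x ⊎ Ratio B A m y
  ratio-split {C} {D} k m x y A B x≥1 le r with A * 3 ^ k ≤? B * x ^ 3
  ... | yes p = inj₁ (ratio p)
  ... | no ¬p = inj₂ (weaken B A {{m*n≢0 D B}} (begin
      A * C * A      ≡⟨ shuffle A C ⟩
      C * (A * A)    ≤⟨ le ⟩
      B * B * D      ≡⟨ shuffle′ B D ⟩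
      B * (D * B)    ∎) (ratio-quotient k m x y A B x≥1 (coratio (<⇒≤ (≰⇒> ¬p))) r))
    where
    shuffle : ∀ a c → a * c * a ≡ c * (a * a)
    shuffle = solve-∀
    shuffle′ : ∀ b d → b * b * d ≡ b * (d * b)
    shuffle′ = solve-∀

  -- Removing v divides 3 ^ ones by at least 3 ^ j but shrinks the value at most by the factor 1 + s
  -- / q. This is how a cheap sum forces its larger summand to be much cheaper.
  ratio-summand : ∀ {C D} k m u v q s j → j ≤ m → q * v ≤ s * u →
    Ratio C D (k + m) (u + v) → Ratio (C * (q + s) ^ 3) (D * q ^ 3 * 3 ^ j) k u
  ratio-summand {C} {D} k m u v q s j j≤m le (ratio r) = ratio (begin
    D * q ^ 3 * 3 ^ j * 3 ^ k       ≤⟨ *-monoˡ-≤ (3 ^ k) (*-monoʳ-≤ (D * q ^ 3) (^-monoʳ-≤ 3 j≤m)) ⟩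
    D * q ^ 3 * 3 ^ m * 3 ^ k       ≡⟨ shuffle D (q ^ 3) (3 ^ m) (3 ^ k) ⟩
    q ^ 3 * (D * (3 ^ k * 3 ^ m))   ≡⟨ cong (λ z → q ^ 3 * (D * z)) (^-distribˡ-+-* 3 k m) ⟨
    q ^ 3 * (D * 3 ^ (k + m))       ≤⟨ *-monoʳ-≤ (q ^ 3) r ⟩
    q ^ 3 * (C * (u + v) ^ 3)       ≡⟨ shuffle′ (q ^ 3) C ((u + v) ^ 3) ⟩
    C * (q ^ 3 * (u + v) ^ 3)       ≡⟨ cong (C *_) (cube-* q (u + v)) ⟨
    C * (q * (u + v)) ^ 3           ≤⟨ *-monoʳ-≤ C (^-monoˡ-≤ 3 stretch) ⟩
    C * ((q + s) * u) ^ 3           ≡⟨ cong (C *_) (cube-* (q + s) u) ⟩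
    C * ((q + s) ^ 3 * u ^ 3)       ≡⟨ *-assoc C ((q + s) ^ 3) (u ^ 3) ⟨
    C * (q + s) ^ 3 * u ^ 3         ∎)
    where
    shuffle : ∀ a b c d → a * b * c * d ≡ b * (a * (d * c))
    shuffle = solve-∀
    shuffle′ : ∀ a b c → a * (b * c) ≡ b * (a * c)
    shuffle′ = solve-∀
    stretch : q * (u + v) ≤ (q + s) * u
    stretch = begin
      q * (u + v)     ≡⟨ *-distribˡ-+ q u v ⟩
      q * u + q * v   ≤⟨ +-monoʳ-≤ (q * u) le ⟩
      q * u + s * u   ≡⟨ *-distribʳ-+ u q s ⟨
      (q + s) * u     ∎

  ratio-comm : ∀ {C D} k m x y → Ratio C D (k + m) (x * y) → Ratio C D (m + k) (y * x)
  ratio-comm k m x y = subst₂ (Ratio _ _) (+-comm k m) (*-comm x y)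

  defect-factorʳ : ∀ {C D} e d .{{_ : NonZero D}} → Defect≤ C D (mul e d) → Defect≤ C D d
  defect-factorʳ {C} {D} e d r = weaken C D {{m*n≢0 D 1}} (≤-reflexive (shuffle C D))
    (ratio-quotient (ones e) (ones d) (value e) (value d) 1 1 (value-pos e) (coratio (*-monoʳ-≤ 1 (cube≤3^ones e))) r)
    where
    shuffle : ∀ a b → 1 * a * b ≡ a * (b * 1)
    shuffle = solve-∀

  defect-factorˡ : ∀ {C D} e d .{{_ : NonZero D}} → Defect≤ C D (mul e d) → Defect≤ C D e
  defect-factorˡ e d r = defect-factorʳ d e (ratio-comm (ones e) (ones d) (value e) (value d) r)

opaque
  by-≤? : ∀ {m n} {_ : True (m ≤? n)} → m ≤ n
  by-≤? {_} {_} {t} = toWitness t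

  by-≰? : ∀ {m n} {_ : False (m ≤? n)} → ¬ m ≤ n
  by-≰? {_} {_} {t} = toWitnessFalse t

  -- With j ones or more in v, `ratio-summand` would give `e` a ratio below 1.
  smaller-summand-< : ∀ {C D} e m v q s j → q * v ≤ s * value e → ¬ D * q ^ 3 * 3 ^ j ≤ C * (q + s) ^ 3 →
    Ratio C D (ones e + m) (value e + v) → m < j
  smaller-summand-< e m v q s j le big r with m <? j
  ... | yes lt = lt
  ... | no ¬lt = contradiction
    (ratio-lower (value-pos e) (cube≤3^ones e) (ratio-summand (ones e) m (value e) v q s j (≮⇒≥ ¬lt) le r)) big

  cube-cancel-< : ∀ {m n} → m ^ 3 < n ^ 3 → m < n
  cube-cancel-< {m} {n} lt with m <? n
  ... | yes m<n = m<n
  ... | no m≮n  = contradiction (^-monoˡ-≤ 3 (≮⇒≥ m≮n)) (<⇒≱ lt)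

  value-< : ∀ e j n → ones e ≤ j → 3 ^ j < n ^ 3 → value e < n
  value-< e j n k≤j lt = cube-cancel-< (≤-<-trans (≤-trans (cube≤3^ones e) (^-monoʳ-≤ 3 k≤j)) lt)

  <-ones : ∀ {k} j n → 3 ^ j < n ^ 3 → n ^ 3 ≤ 3 ^ k → j < k
  <-ones j n lt le = 3^-cancel-< j _ (<-≤-trans lt le)

-- Numbers up to powers of 3

record Leader (c f k n : ℕ) : Set where
  constructor leader
  field
    power    : ℕ
    product≡ : n ≡ 3 ^ power * c
    -- An inequality, since the expression behind k may waste ones; ratio bounds for (k , n) pass to
    -- (f , c) because a factor 3 at cost 3 has ratio 1.
    cost≤    : f + 3 * power ≤ k

open Leader

opaque
  leader-refl : ∀ {c f k} → f ≤ k → Leader c f k c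
  leader-refl {c} {f} f≤k = leader 0 (sym (+-identityʳ c)) (subst (_≤ _) (sym (+-identityʳ f)) f≤k)

  leader-* : ∀ {c f k n c' f' k' n'} → Leader c f k n → Leader c' f' k' n' →
    Leader (c * c') (f + f') (k + k') (n * n')
  leader-* {c} {f} {c' = c'} {f'} (leader l refl le) (leader l' refl le') = leader (l + l')
    (trans (shuffle (3 ^ l) c (3 ^ l') c') (cong (_* (c * c')) (sym (^-distribˡ-+-* 3 l l'))))
    (≤-trans (≤-reflexive (shuffle′ f f' l l')) (+-mono-≤ le le'))
    where
    shuffle : ∀ a b c d → a * b * (c * d) ≡ a * c * (b * d)
    shuffle = solve-∀
    shuffle′ : ∀ a b c d → a + b + 3 * (c + d) ≡ a + 3 * c + (b + 3 * d)
    shuffle′ = solve-∀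

  leader-cube : ∀ {c f k n} (L : Leader c f k n) → n ^ 3 ≡ 3 ^ (3 * power L) * c ^ 3
  leader-cube {c} (leader l refl _) = trans (cube-* (3 ^ l) c) (cong (_* c ^ 3) (cube-3^ l))

  leader-coratio : ∀ {E F c f k n} → CoRatio E F f c → Leader c f k n → CoRatio E F k n
  leader-coratio {E} {F} {c} {f} {k} {n} (coratio le) L@(leader l _ cost) = coratio (begin
    F * n ^ 3                   ≡⟨ cong (F *_) (leader-cube L) ⟩
    F * (3 ^ (3 * l) * c ^ 3)   ≡⟨ shuffle F (3 ^ (3 * l)) (c ^ 3) ⟩
    F * c ^ 3 * 3 ^ (3 * l)     ≤⟨ *-monoˡ-≤ (3 ^ (3 * l)) le ⟩
    E * 3 ^ f * 3 ^ (3 * l)     ≡⟨ *-assoc E (3 ^ f) (3 ^ (3 * l)) ⟩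
    E * (3 ^ f * 3 ^ (3 * l))   ≡⟨ cong (E *_) (^-distribˡ-+-* 3 f (3 * l)) ⟨
    E * 3 ^ (f + 3 * l)         ≤⟨ *-monoʳ-≤ E (^-monoʳ-≤ 3 cost) ⟩
    E * 3 ^ k                   ∎)
    where
    shuffle : ∀ a b c → a * (b * c) ≡ a * c * b
    shuffle = solve-∀

  leader-ratio : ∀ {C D c f k n} → Leader c f k n → Ratio C D k n → Ratio C D f c
  leader-ratio {C} {D} {c} {f} {k} {n} L@(leader l _ cost) (ratio r) =
    ratio (*-cancelˡ-≤ (3 ^ (3 * l)) {{m^n≢0 3 (3 * l)}} (begin
      3 ^ (3 * l) * (D * 3 ^ f)   ≡⟨ shuffle (3 ^ (3 * l)) D (3 ^ f) ⟩
      D * (3 ^ f * 3 ^ (3 * l))   ≡⟨ cong (D *_) (^-distribˡ-+-* 3 f (3 * l)) ⟨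
      D * 3 ^ (f + 3 * l)         ≤⟨ *-monoʳ-≤ D (^-monoʳ-≤ 3 cost) ⟩
      D * 3 ^ k                   ≤⟨ r ⟩
      C * n ^ 3                   ≡⟨ cong (C *_) (leader-cube L) ⟩
      C * (3 ^ (3 * l) * c ^ 3)   ≡⟨ shuffle′ C (3 ^ (3 * l)) (c ^ 3) ⟩
      3 ^ (3 * l) * (C * c ^ 3)   ∎))
    where
    shuffle : ∀ a b c → a * (b * c) ≡ b * (c * a)
    shuffle = solve-∀
    shuffle′ : ∀ a b c → a * (b * c) ≡ b * (a * c)
    shuffle′ = solve-∀

ratio? : ∀ C D k n → Dec (Ratio C D k n)
ratio? C D k n = map′ ratio bound (D * 3 ^ k ≤? C * n ^ 3)

coratio? : ∀ E F k n → Dec (CoRatio E F k n)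
coratio? E F k n = map′ coratio lower (F * n ^ 3 ≤? E * 3 ^ k)

-- The pairs (c , f) of a number and its complexity with 25 · 3 ^ f ≤ 83 · c ^ 3, up to powers of 3 and the
-- family 3 ^ p + 1; (1 , 0) stands for the powers of 3 themselves.
leaders : List (ℕ × ℕ)
leaders =
  (1 , 0) ∷ (2 , 2) ∷ (4 , 4) ∷ (8 , 6) ∷ (16 , 8) ∷ (32 , 10) ∷ (64 , 12) ∷ (128 , 14) ∷ (256 , 16) ∷
  (512 , 18) ∷ (1024 , 20) ∷ (5 , 5) ∷ (10 , 7) ∷ (20 , 9) ∷ (40 , 11) ∷ (80 , 13) ∷ (7 , 6) ∷ (14 , 8) ∷
  (28 , 10) ∷ (56 , 12) ∷ (13 , 8) ∷ (19 , 9) ∷ (38 , 11) ∷ (55 , 12) ∷ (82 , 13) ∷ (163 , 15) ∷ (164 , 15) ∷ []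

_∈leaders? : ∀ x → Dec (x ∈ leaders)
x ∈leaders? = any? (≡-dec _≟_ _≟_ x) leaders

Listed : ℕ → ℕ → Set
Listed k n = ∃ λ c → ∃ λ f → (c , f) ∈ leaders × Leader c f k n

listed : ∀ {k n} c f {_ : True ((c , f) ∈leaders?)} → Leader c f k n → Listed k n
listed c f {t} L = c , f , toWitness t , L

opaque
  -- In this range the least k with n ^ 3 ≤ 3 ^ k is already the listed cost.
  small-listed : ∀ n k → 1 ≤ n → n ≤ 7 → n ^ 3 ≤ 3 ^ k → Listed k n
  small-listed 1 k _ _ le = listed 1 0 (leader-refl z≤n)
  small-listed 2 k _ _ le = listed 2 2 (leader-refl (<-ones 1 2 by-≤? le))
  small-listed 3 k _ _ le = listed 1 0 (leader 1 refl (<-ones 2 3 by-≤? le))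
  small-listed 4 k _ _ le = listed 4 4 (leader-refl (<-ones 3 4 by-≤? le))
  small-listed 5 k _ _ le = listed 5 5 (leader-refl (<-ones 4 5 by-≤? le))
  small-listed 6 k _ _ le = listed 2 2 (leader 1 refl (<-ones 4 6 by-≤? le))
  small-listed 7 k _ _ le = listed 7 6 (leader-refl (<-ones 5 7 by-≤? le))
  small-listed (suc (suc (suc (suc (suc (suc (suc (suc _)))))))) k _
    (s≤s (s≤s (s≤s (s≤s (s≤s (s≤s (s≤s ()))))))) le

-- Numbers of small defect

-- 97/50 is just below the ratio 243/125 of the number 5, and (9/8)³⁹ / 27 < (97/50)².
Smooth : ℕ → ℕ → Set
Smooth k n = ∃ λ a → a < 6 × Leader (2 ^ a) (2 * a) k n

opaque
  smooth-check : ∀ {c f} → (c , f) ∈ leaders → Ratio 97 50 f c → ∃ λ a → a < 6 × (c ≡ 2 ^ a × f ≡ 2 * a)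
  smooth-check = lookup (toWitness {a? = all? (λ (c , f) → ratio? 97 50 f c →-dec
    anyUpTo? (λ a → (c ≟ 2 ^ a) ×-dec (f ≟ 2 * a)) 6) leaders} _)

  smooth-exponent : ∀ {a} → a < 11 → Ratio 97 50 (2 * a) (2 ^ a) → a < 6
  smooth-exponent = toWitness {a? = allUpTo? (λ a → ratio? 97 50 (2 * a) (2 ^ a) →-dec a <? 6) 11} _

  smooth-exponent-<2 : ∀ {a} → a < 6 → Ratio 5 4 (2 * a) (2 ^ a) → a < 2
  smooth-exponent-<2 = toWitness {a? = allUpTo? (λ a → ratio? 5 4 (2 * a) (2 ^ a) →-dec a <? 2) 6} _

listed⇒smooth : ∀ {k n} → Ratio 97 50 k n → Listed k n → Smooth k n
listed⇒smooth {k} {n} r (c , f , c∈ , L) =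
  let a , a<6 , c≡ , f≡ = smooth-check c∈ (leader-ratio L r)
  in a , a<6 , subst₂ (λ c f → Leader c f k n) c≡ f≡ L

-- A single `one` has ratio 3 and is excluded. In a sum the smaller summand has at most 2 ones; next
-- to it a partner of at least 7 (for 1) or 3 (for 2) would get a ratio below 1, so only sums up to
-- 7 remain.
classify-smooth : ∀ e → Defect≤ 97 50 e → Smooth (ones e) (value e)
classify-smooth one r = contradiction (bound r) by-≰?
classify-smooth (mul e d) r
  with classify-smooth e (defect-factorˡ e d r) | classify-smooth d (defect-factorʳ e d r)
... | a , s≤s a≤5 , L | a' , s≤s a'≤5 , L' =
  a + a' , smooth-exponent (s≤s (+-mono-≤ a≤5 a'≤5)) (leader-ratio L″ r) , L″
  where
  L″ : Leader (2 ^ (a + a')) (2 * (a + a')) (ones e + ones d) (value e * value d)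
  L″ = subst₂ (λ c f → Leader c f (ones e + ones d) (value e * value d))
    (sym (^-distribˡ-+-* 2 a a')) (sym (*-distribˡ-+ 2 a a')) (leader-* L L')
classify-smooth (add e d) = add-wlog (λ k n → Ratio 97 50 k n → Smooth k n) sum e d
  where
  sum : ∀ e d → value d ≤ value e → Ratio 97 50 (ones e + ones d) (value e + value d) →
    Smooth (ones e + ones d) (value e + value d)
  sum e d d≤e r = listed⇒smooth r (small-listed _ _ (value-pos (add e d)) (n≤7 (value d) refl) (cube≤3^ones (add e d)))
    where
    d<3 : value d < 3
    d<3 = value-< d 2 3 (≤-pred (smaller-summand-< e (ones d) (value d) 1 1 3 (*-monoʳ-≤ 1 d≤e) by-≰? r)) by-≤?
    n≤7 : ∀ v → value d ≡ v → value e + value d ≤ 7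
    n≤7 0 eq = contradiction (subst (1 ≤_) eq (value-pos d)) λ ()
    n≤7 1 eq with value e ≤? 6
    ... | yes e≤6 = +-mono-≤ e≤6 (≤-reflexive eq)
    ... | no e≰6 = contradiction (smaller-summand-< e (ones d) (value d) 7 1 1
            (≤-trans (*-monoʳ-≤ 7 (≤-reflexive eq)) (*-monoʳ-≤ 1 (≰⇒> e≰6))) by-≰? r) (≤⇒≯ (ones-pos d))
    n≤7 2 eq with value e ≤? 2
    ... | yes e≤2 = ≤-trans (+-mono-≤ e≤2 (≤-reflexive eq)) by-≤?
    ... | no e≰2 = contradiction (smaller-summand-< e (ones d) (value d) 3 2 2
            (≤-trans (*-monoʳ-≤ 3 (≤-reflexive eq)) (*-monoʳ-≤ 2 (≰⇒> e≰2))) by-≰? r)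
            (≤⇒≯ (<-ones 1 2 by-≤? (subst (λ v → v ^ 3 ≤ 3 ^ ones d) eq (cube≤3^ones d))))
    n≤7 (suc (suc (suc v))) eq = contradiction (subst (_< 3) eq d<3) λ { (s≤s (s≤s (s≤s ()))) }

-- Since (9/8)³⁹ / 9 < (83/25)², one of two factors of 2 ^ i * 3 ^ J − 1 falls under this classification if the product
-- is cheap enough to matter.
Near3^ : ℕ → ℕ → Set
Near3^ k n = ∃ λ p → 5 ≤ p × Leader (3 ^ p + 1) (3 * p + 1) k n

opaque
  leaders-closed : ∀ {c f} → (c , f) ∈ leaders → ∀ {a} → a < 6 → Ratio 83 25 (2 * a + f) (2 ^ a * c) →
    (2 ^ a * c , 2 * a + f) ∈ leaders
  leaders-closed = lookup (toWitness {a? = all? (λ (c , f) → allUpTo? (λ a → ratio? 83 25 (2 * a + f) (2 ^ a * c) →-dec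
    ((2 ^ a * c , 2 * a + f) ∈leaders?)) 6) leaders} _)

  ratio-ones : ∀ {C D k k' n} → k ≤ k' → Ratio C D k' n → Ratio C D k n
  ratio-ones {D = D} k≤k' (ratio r) = ratio (≤-trans (*-monoʳ-≤ D (^-monoʳ-≤ 3 k≤k')) r)

  ratio-lower-by : ∀ {C D k n} E F → 1 ≤ n → CoRatio E F k n → Ratio C D k n → D * F ≤ E * C
  ratio-lower-by {C} {D} {k} {n} E F n≥1 (coratio le) (ratio r) =
    *-cancelʳ-≤ (D * F) (E * C) (n ^ 3) {{cube-nonZero n≥1}} (begin
      D * F * n ^ 3       ≡⟨ *-assoc D F (n ^ 3) ⟩
      D * (F * n ^ 3)     ≤⟨ *-monoʳ-≤ D le ⟩
      D * (E * 3 ^ k)     ≡⟨ shuffle D E (3 ^ k) ⟩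
      E * (D * 3 ^ k)     ≤⟨ *-monoʳ-≤ E r ⟩
      E * (C * n ^ 3)     ≡⟨ *-assoc E C (n ^ 3) ⟨
      E * C * n ^ 3       ∎)
    where
    shuffle : ∀ a b c → a * (b * c) ≡ b * (a * c)
    shuffle = solve-∀

  -- The numbers 3 ^ l 2 ^ a + 1 before the ratio is close to its limit 3 (9/8) ^ a; from l = 5 on,
  -- only a = 0 stays below 83/25.
  one-more-check : ∀ {a} → a < 6 → ∀ {l} → l < 5 → 7 ≤ 3 ^ l * 2 ^ a →
    Ratio 83 25 (2 * a + 3 * l + 1) (3 ^ l * 2 ^ a + 1) →
    ∃ λ l' → l' < 5 × Any (λ (c , f) → 3 ^ l * 2 ^ a + 1 ≡ 3 ^ l' * c × f + 3 * l' ≤ 2 * a + 3 * l + 1) leaders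
  one-more-check = toWitness {a? = allUpTo? (λ a → allUpTo? (λ l → (7 ≤? 3 ^ l * 2 ^ a) →-dec
    (ratio? 83 25 (2 * a + 3 * l + 1) (3 ^ l * 2 ^ a + 1) →-dec
    anyUpTo? (λ l' → any? (λ (c , f) → (3 ^ l * 2 ^ a + 1 ≟ 3 ^ l' * c) ×-dec (f + 3 * l' ≤? 2 * a + 3 * l + 1)) leaders) 5)) 5) 6} _

  2³<3² : ∀ {a} → a < 5 → CoRatio 8 9 (2 * suc a) (2 ^ suc a)
  2³<3² = toWitness {a? = allUpTo? (λ a → coratio? 8 9 (2 * suc a) (2 ^ suc a)) 5} _

  243≤3^ : ∀ {p} → 5 ≤ p → 243 ≤ 3 ^ p
  243≤3^ p≥5 = ^-monoʳ-≤ 3 p≥5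

  leaders-* : ∀ {k m x y} → Smooth k x → Listed m y ⊎ Near3^ m y → Ratio 83 25 (k + m) (x * y) →
    Listed (k + m) (x * y) ⊎ Near3^ (k + m) (x * y)
  leaders-* (a , a<6 , L) (inj₁ (c , f , c∈ , L')) r =
    inj₁ (2 ^ a * c , 2 * a + f , leaders-closed c∈ a<6 (leader-ratio (leader-* L L') r) , leader-* L L')
  leaders-* {k} {m} {x} {y} (zero , _ , L) (inj₂ (p , p≥5 , L')) r =
    inj₂ (p , p≥5 , subst (λ c → Leader c (3 * p + 1) (k + m) (x * y)) (+-identityʳ (3 ^ p + 1)) (leader-* L L'))
  -- The ratio of 2 (3 ^ p + 1) tends to 27/8 and exceeds 83/25 from p = 5 on; 164 = 2 · 82 is the
  -- last such number in the list.
  leaders-* {k} {m} {x} {y} (suc a , s≤s a<5 , L) (inj₂ (p , p≥5 , L')) r = contradiction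
    (ratio-lower (m^n>0 3 p) (≤-reflexive (cube-3^ p))
      (ratio-summand (3 * p) 1 (3 ^ p) 1 243 1 1 ≤-refl
        (subst (243 ≤_) (sym (+-identityʳ (3 ^ p))) (243≤3^ p≥5))
        (ratio-quotient (2 * suc a) (3 * p + 1) (2 ^ suc a) (3 ^ p + 1) 8 9 (m^n>0 2 (suc a)) (2³<3² a<5)
          (leader-ratio (leader-* L L') r))))
    by-≰?

  -- Since 83/25 < (97/50)², a product has a factor in `Smooth`. In a sum beyond 7 the smaller
  -- summand must be 1, and its 1 brings the partner, which is at least 7, below 97/50.
  classify : ∀ e → Defect≤ 83 25 e → Listed (ones e) (value e) ⊎ Near3^ (ones e) (value e)
  classify one r = inj₁ (1 , 0 , here refl , leader-refl z≤n)
  classify (mul e d) r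
    with ratio-split (ones e) (ones d) (value e) (value d) 50 97 (value-pos e) by-≤? r
  ... | inj₁ re = leaders-* (classify-smooth e re) (classify d (defect-factorʳ e d r)) r
  ... | inj₂ rd = subst₂ (λ k n → Listed k n ⊎ Near3^ k n) (+-comm (ones d) (ones e)) (*-comm (value d) (value e))
    (leaders-* (classify-smooth d rd) (classify e (defect-factorˡ e d r))
      (ratio-comm (ones e) (ones d) (value e) (value d) r))
  classify (add e d) = add-wlog (λ k n → Ratio 83 25 k n → Listed k n ⊎ Near3^ k n) sum e d
    where
    sum : ∀ e d → value d ≤ value e → Ratio 83 25 (ones e + ones d) (value e + value d) →
      Listed (ones e + ones d) (value e + value d) ⊎ Near3^ (ones e + ones d) (value e + value d)
    sum e d d≤e r = by-size (value d) refl
      where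
      K N : ℕ
      K = ones e + ones d
      N = value e + value d
      small : N ≤ 7 → Listed K N ⊎ Near3^ K N
      small N≤7 = inj₁ (small-listed N K (value-pos (add e d)) N≤7 (cube≤3^ones (add e d)))
      d<3 : value d < 3
      d<3 = value-< d 2 3 (≤-pred (smaller-summand-< e (ones d) (value d) 1 1 3 (*-monoʳ-≤ 1 d≤e) by-≰? r)) by-≤?
      scale : ∀ q s → q ≤ value e → value d ≤ s → q * value d ≤ s * value e
      scale q s q≤ ≤s = ≤-trans (*-mono-≤ q≤ ≤s) (≤-reflexive (*-comm (value e) s))
      successor : ∀ a l → a < 6 → value e ≡ 3 ^ l * 2 ^ a → 2 * a + 3 * l ≤ ones e → value d ≡ 1 → 7 ≤ value e →
        Listed K N ⊎ Near3^ K N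
      successor a l a<6 e≡ cost d≡ e≥7 with l <? 5
      ... | yes l<5 =
        let l' , _ , found = one-more-check a<6 l<5 (subst (7 ≤_) e≡ e≥7)
                               (ratio-ones cost+1 (subst (Ratio 83 25 K) N≡ r))
            (c , f) , c∈ , eq , le = find found
        in inj₁ (c , f , c∈ , leader l' (trans N≡ eq) (≤-trans le cost+1))
        where
        N≡ : N ≡ 3 ^ l * 2 ^ a + 1
        N≡ = cong₂ _+_ e≡ d≡
        cost+1 : 2 * a + 3 * l + 1 ≤ K
        cost+1 = +-mono-≤ cost (ones-pos d)
      ... | no l≮5 = large a a<6 e≡ cost
        where
        large : ∀ a → a < 6 → value e ≡ 3 ^ l * 2 ^ a → 2 * a + 3 * l ≤ ones e → Listed K N ⊎ Near3^ K N
        large zero _ e≡ cost = inj₂ (l , ≮⇒≥ l≮5 , leader 0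
          (trans (cong₂ _+_ (trans e≡ (*-identityʳ (3 ^ l))) d≡) (sym (+-identityʳ (3 ^ l + 1))))
          (≤-trans (≤-reflexive (+-identityʳ (3 * l + 1))) (+-mono-≤ cost (ones-pos d))))
        -- An even partner contributes at least 9/8, and 3 · 9/8 = 27/8 lies above 83/25 by more
        -- than the correction (244/243)³.
        large (suc a) (s≤s a<5) e≡ cost = contradiction
          (ratio-lower-by 8 9 (m^n>0 2 (suc a)) (2³<3² a<5)
            (leader-ratio L
              (ratio-summand (ones e) (ones d) (value e) (value d) 243 1 1 (ones-pos d)
                (scale 243 1 243≤e (≤-reflexive d≡)) r)))
          by-≰?
          where
          L : Leader (2 ^ suc a) (2 * suc a) (ones e) (value e)
          L = leader l e≡ cost
          243≤e : 243 ≤ value e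
          243≤e = ≤-trans (243≤3^ (≮⇒≥ l≮5)) (≤-trans (m≤m*n (3 ^ l) (2 ^ suc a) {{m^n≢0 2 (suc a)}}) (≤-reflexive (sym e≡)))
      by-size : ∀ v → value d ≡ v → Listed K N ⊎ Near3^ K N
      by-size 0 eq = contradiction (subst (1 ≤_) eq (value-pos d)) λ ()
      by-size 1 eq with value e ≤? 6
      ... | yes e≤6 = small (+-mono-≤ e≤6 (≤-reflexive eq))
      ... | no e≰6 with classify-smooth e (weaken 97 50 by-≤? (ratio-summand (ones e) (ones d) (value e) (value d) 7 1 1
                     (ones-pos d) (scale 7 1 (≰⇒> e≰6) (≤-reflexive eq)) r))
      ...   | a , a<6 , leader l e≡ cost = successor a l a<6 e≡ cost eq (≰⇒> e≰6)
      by-size 2 eq with value e ≤? 5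
      ... | yes e≤5 = small (+-mono-≤ e≤5 (≤-reflexive eq))
      ... | no e≰5 = contradiction (smaller-summand-< e (ones d) (value d) 6 2 2 (scale 6 2 (≰⇒> e≰5) (≤-reflexive eq)) by-≰? r)
              (≤⇒≯ (<-ones 1 2 by-≤? (subst (λ v → v ^ 3 ≤ 3 ^ ones d) eq (cube≤3^ones d))))
      by-size (suc (suc (suc v))) eq = contradiction (subst (_< 3) eq d<3) λ { (s≤s (s≤s (s≤s ()))) }

-- Residues of powers of 3

opaque
  by-∤? : ∀ {m n} {_ : False (m ∣? n)} → ¬ m ∣ n
  by-∤? {_} {_} {t} = toWitnessFalse t

  3^-mod-8 : ∀ m → ∃ λ q → 3 ^ m ≡ 8 * q + 1 ⊎ 3 ^ m ≡ 8 * q + 3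
  3^-mod-8 zero = 0 , inj₁ refl
  3^-mod-8 (suc m) with 3^-mod-8 m
  ... | q , inj₁ eq = 3 * q , inj₂ (trans (cong (3 *_) eq) (expand q))
    where
    expand : ∀ q → 3 * (8 * q + 1) ≡ 8 * (3 * q) + 3
    expand = solve-∀
  ... | q , inj₂ eq = 3 * q + 1 , inj₁ (trans (cong (3 *_) eq) (expand q))
    where
    expand : ∀ q → 3 * (8 * q + 3) ≡ 8 * (3 * q + 1) + 1
    expand = solve-∀

  8∤3^+ : ∀ m {w} → w < 4 → ¬ 8 ∣ 3 ^ m + w
  8∤3^+ m {w} w<4 8∣ with 3^-mod-8 m
  ... | q , inj₁ eq = toWitness {a? = allUpTo? (λ w → ¬? (8 ∣? 1 + w)) 4} _ w<4
    (∣m+n∣m⇒∣n (subst (8 ∣_) (trans (cong (_+ w) eq) (+-assoc (8 * q) 1 w)) 8∣) (m∣m*n q))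
  ... | q , inj₂ eq = toWitness {a? = allUpTo? (λ w → ¬? (8 ∣? 3 + w)) 4} _ w<4
    (∣m+n∣m⇒∣n (subst (8 ∣_) (trans (cong (_+ w) eq) (+-assoc (8 * q) 3 w)) 8∣) (m∣m*n q))

  2∣3^+1 : ∀ p → 2 ∣ 3 ^ p + 1
  2∣3^+1 zero = divides 1 refl
  2∣3^+1 (suc p) = subst (2 ∣_) (expand (3 ^ p)) (∣m∣n⇒∣m+n (2∣3^+1 p) (m∣m*n (3 ^ p)))
    where
    expand : ∀ x → x + 1 + 2 * x ≡ 3 * x + 1
    expand = solve-∀

  leader-odd : ∀ {c f k n} → ¬ 2 ∣ n → Leader c f k n → ¬ 2 ∣ c
  leader-odd odd (leader l refl _) 2∣c = odd (∣n⇒∣m*n (3 ^ l) 2∣c)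

  odd⇒¬near3^ : ∀ {k n} → ¬ 2 ∣ n → ¬ Near3^ k n
  odd⇒¬near3^ odd (p , _ , L) = leader-odd odd L (2∣3^+1 p)

  odd-leader-≤ : ∀ {c f} → (c , f) ∈ leaders → ¬ 2 ∣ c → c ≤ 163
  odd-leader-≤ = lookup (toWitness {a? = all? (λ (c , f) → ¬? (2 ∣? c) →-dec (c ≤? 163)) leaders} _)

  -- Among the odd leaders other than 1, the cheapest is 5 with ratio 243/125.
  odd-leader-defect : ∀ {c f} → (c , f) ∈ leaders → ¬ 2 ∣ c → c ≡ 1 ⊎ CoRatio 125 243 f c
  odd-leader-defect = lookup (toWitness {a? = all? (λ (c , f) → ¬? (2 ∣? c) →-dec ((c ≟ 1) ⊎-dec coratio? 125 243 f c)) leaders} _)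

  odd-leader-≤7 : ∀ {c f} → (c , f) ∈ leaders → ¬ 2 ∣ c → Ratio 12 5 f c → c ≤ 7
  odd-leader-≤7 = lookup (toWitness {a? = all? (λ (c , f) → ¬? (2 ∣? c) →-dec (ratio? 12 5 f c →-dec (c ≤? 7))) leaders} _)

-- 283/50 bounds (9/8)³⁹ / 9 divided by 243/125: this is what remains for the second factor of 2 ^ i * 3 ^ J − 1.
OddForm : ℕ → Set
OddForm n = (∃ λ l → ∃ λ c → c ≤ 1200 × n ≡ 3 ^ l * c) ⊎
            (∃ λ l → ∃ λ a → ∃ λ k → a < 6 × n ≡ 3 ^ l * (3 ^ k * 2 ^ a + 1))

opaque
  3^-*-assoc : ∀ m l c → 3 ^ m * (3 ^ l * c) ≡ 3 ^ (m + l) * c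
  3^-*-assoc m l c = trans (sym (*-assoc (3 ^ m) (3 ^ l) c)) (cong (_* c) (sym (^-distribˡ-+-* 3 m l)))

  oddForm-3^ : ∀ m {n} → OddForm n → OddForm (3 ^ m * n)
  oddForm-3^ m (inj₁ (l , c , c≤ , refl)) = inj₁ (m + l , c , c≤ , 3^-*-assoc m l c)
  oddForm-3^ m (inj₂ (l , a , k , a<6 , refl)) = inj₂ (m + l , a , k , a<6 , 3^-*-assoc m l _)

  -- As 283/50 < (12/5)², a product has a factor of ratio at most 12/5, hence with leader 1, 5 or 7.
  -- Leader 1 means a power of 3, which is split off. Otherwise the partner has ratio at most
  -- (283/50) (125/243) < 83/25 and an odd leader at most 163; 1200 leaves room for 7 · 163 = 1141.
  classify-odd : ∀ e → ¬ 2 ∣ value e → Defect≤ 283 50 e → OddForm (value e)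
  classify-odd one _ _ = inj₁ (0 , 1 , by-≤? , refl)
  classify-odd (mul e d) odd r = by-split (ratio-split (ones e) (ones d) (value e) (value d) 5 12 (value-pos e) by-≤? r)
    where
    product : ∀ e d → ¬ 2 ∣ value e → ¬ 2 ∣ value d → OddForm (value d) → Defect≤ 12 5 e → Defect≤ 283 50 (mul e d) →
      OddForm (value e * value d)
    product e d oddₑ oddᵈ IH rₑ r = by-leader (classify e (weaken 83 25 by-≤? rₑ))
      where
      by-leader : Listed (ones e) (value e) ⊎ Near3^ (ones e) (value e) → OddForm (value e * value d)
      by-leader (inj₂ near) = contradiction near (odd⇒¬near3^ oddₑ)
      by-leader (inj₁ (c , f , c∈ , L@(leader l e≡ _))) = by-defect (odd-leader-defect c∈ (leader-odd oddₑ L))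
        where
        by-leader′ : Listed (ones d) (value d) ⊎ Near3^ (ones d) (value d) → OddForm (value e * value d)
        by-leader′ (inj₂ near) = contradiction near (odd⇒¬near3^ oddᵈ)
        by-leader′ (inj₁ (c' , f' , c'∈ , L'@(leader l' d≡ _))) = inj₁ (power (leader-* L L') , c * c' ,
          ≤-trans (*-mono-≤ (odd-leader-≤7 c∈ (leader-odd oddₑ L) (leader-ratio L rₑ))
                            (odd-leader-≤ c'∈ (leader-odd oddᵈ L'))) by-≤? ,
          product≡ (leader-* L L'))
        by-defect : c ≡ 1 ⊎ CoRatio 125 243 f c → OddForm (value e * value d)
        by-defect (inj₁ refl) =
          subst (λ x → OddForm (x * value d)) (sym (trans e≡ (*-identityʳ (3 ^ l)))) (oddForm-3^ l IH)
        by-defect (inj₂ c-defect) = by-leader′ (classify d (weaken 83 25 by-≤?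
          (ratio-quotient (ones e) (ones d) (value e) (value d) 125 243 (value-pos e) (leader-coratio c-defect L) r)))
    oddₑ : ¬ 2 ∣ value e
    oddₑ 2∣ = odd (∣m⇒∣m*n (value d) 2∣)
    oddᵈ : ¬ 2 ∣ value d
    oddᵈ 2∣ = odd (∣n⇒∣m*n (value e) 2∣)
    by-split : Defect≤ 12 5 e ⊎ Defect≤ 12 5 d → OddForm (value e * value d)
    by-split (inj₁ rₑ) = product e d oddₑ oddᵈ (classify-odd d oddᵈ (defect-factorʳ e d r)) rₑ r
    by-split (inj₂ rᵈ) = subst OddForm (*-comm (value d) (value e))
      (product d e oddᵈ oddₑ (classify-odd e oddₑ (defect-factorˡ e d r)) rᵈ
        (ratio-comm (ones e) (ones d) (value e) (value d) r))
  classify-odd (add e d) _ = add-wlog (λ k n → Ratio 283 50 k n → OddForm n) sum e d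
    where
    sum : ∀ e d → value d ≤ value e → Ratio 283 50 (ones e + ones d) (value e + value d) → OddForm (value e + value d)
    sum e d d≤e r with value e + value d ≤? 1200
    -- A sum up to 1200 has the first form by itself. Beyond that the larger summand is at least
    -- 1000, which forces the smaller one to be 1 and the larger one to be smooth.
    ... | yes small = inj₁ (0 , value e + value d , small , sym (+-identityʳ _))
    ... | no large = successor (classify-smooth e (weaken 97 50 by-≤?
        (ratio-summand (ones e) (ones d) (value e) (value d) 1000 3 1 (ones-pos d) 1000d≤3e r)))
      where
      d<4 : value d < 4
      d<4 = value-< d 3 4 (≤-pred (smaller-summand-< e (ones d) (value d) 1 1 4 (*-monoʳ-≤ 1 d≤e) by-≰? r)) by-≤?
      1000≤e : 1000 ≤ value e
      1000≤e = +-cancelʳ-≤ 4 1000 (value e) (≤-trans by-≤? (≤-trans (<⇒≤ (≰⇒> large)) (+-monoʳ-≤ (value e) (<⇒≤ d<4))))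
      1000d≤3e : 1000 * value d ≤ 3 * value e
      1000d≤3e = ≤-trans (*-mono-≤ 1000≤e (≤-pred d<4)) (≤-reflexive (*-comm (value e) 3))
      d≡1 : value d ≡ 1
      d≡1 = ≤-antisym (≤-pred (value-< d 1 2 (≤-pred
        (smaller-summand-< e (ones d) (value d) 1000 3 2 1000d≤3e by-≰? r)) by-≤?)) (value-pos d)
      successor : Smooth (ones e) (value e) → OddForm (value e + value d)
      successor (a , a<6 , leader l e≡ _) = inj₂ (0 , a , l , a<6 , trans (cong₂ _+_ e≡ d≡1) (sym (+-identityʳ _)))

-- Equations in powers of 2 and 3 (exponents of 3 below 26 suffice, as 2 ^ 39 < 3 ^ 26)

opaque
  check-3^t∙2c+2 : ∀ {i} → i < 40 → 10 ≤ i → ∀ {t} → t < 26 → All (λ (c , f) → ¬ 2 ∣ c → 3 ^ t * (2 * c) + 2 ≢ 2 ^ i) leaders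
  check-3^t∙2c+2 = toWitness {a? = allUpTo? (λ i → (10 ≤? i) →-dec (allUpTo? (λ t → all? (λ (c , f) → ¬? (2 ∣? c) →-dec
    ¬? (3 ^ t * (2 * c) + 2 ≟ 2 ^ i)) leaders) 26)) 40} _

  -- Only small powers of 3 divide 2 ^ i - 2, so the cofactor is at least 600; this size makes the
  -- larger summand in `shift≢2-add` cheap enough.
  check-3^l∙[3^k+1]+2 : ∀ {i} → i < 40 → 10 ≤ i → ∀ {l} → l < 26 → 1 ≤ l → 3 ^ l ∣ 2 ^ i ∸ 2 →
    600 * 3 ^ l + 2 ≤ 2 ^ i × (∀ {k} → k < 26 → 3 ^ l * (3 ^ k + 1) + 2 ≢ 2 ^ i)
  check-3^l∙[3^k+1]+2 = toWitness {a? = allUpTo? (λ i → (10 ≤? i) →-dec (allUpTo? (λ l → (1 ≤? l) →-dec ((3 ^ l ∣? 2 ^ i ∸ 2) →-dec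
    ((600 * 3 ^ l + 2 ≤? 2 ^ i) ×-dec allUpTo? (λ k → ¬? (3 ^ l * (3 ^ k + 1) + 2 ≟ 2 ^ i)) 26))) 26)) 40} _

  -- 195600 = 163 · 1200 bounds an odd leader times a cofactor from `OddForm`. No power of 3 beyond
  -- 27 divides 2 ^ i - 1 in this range.
  check-size : ∀ {i} → i < 40 → 19 ≤ i → ∀ {l} → l < 26 → 3 ^ l ∣ 2 ^ i ∸ 1 → 195600 * 3 ^ l + 1 < 2 ^ i
  check-size = toWitness {a? = allUpTo? (λ i → (19 ≤? i) →-dec (allUpTo? (λ l → (3 ^ l ∣? 2 ^ i ∸ 1) →-dec
    (195600 * 3 ^ l + 1 <? 2 ^ i)) 26)) 40} _

  -- 2 ^ i is 1 modulo 3 only for even i, which excludes 39 and lowers (9/8) ^ i / 9 from about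
  -- 10.98 to 9.76.
  check-even : ∀ {i} → i < 40 → 19 ≤ i → 3 ∣ 2 ^ i ∸ 1 → i ≤ 38
  check-even = toWitness {a? = allUpTo? (λ i → (19 ≤? i) →-dec ((3 ∣? 2 ^ i ∸ 1) →-dec (i ≤? 38))) 40} _

  -- The divisibility follows from each of the equations; as a premise it leaves very few l before
  -- the inner searches start.
  check-sum : ∀ {i} → i < 40 → 19 ≤ i → ∀ {l} → l < 26 → 1 ≤ l → 3 ^ l ∣ 2 ^ i ∸ 1 → ∀ {m} → m < 26 →
    3 ^ l * (3 ^ m + 2) + 1 ≢ 2 ^ i ×
    All (λ (c , f) → 3 ^ l * (3 ^ m * c + 1) + 1 ≢ 2 ^ i) leaders ×
    (∀ {p} → p < 26 → 3 ^ l * (3 ^ m * (3 ^ p + 1) + 1) + 1 ≢ 2 ^ i)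
  check-sum = toWitness {a? = allUpTo? (λ i → (19 ≤? i) →-dec (allUpTo? (λ l → (1 ≤? l) →-dec ((3 ^ l ∣? 2 ^ i ∸ 1) →-dec
    allUpTo? (λ m → ¬? (3 ^ l * (3 ^ m + 2) + 1 ≟ 2 ^ i) ×-dec
      (all? (λ (c , f) → ¬? (3 ^ l * (3 ^ m * c + 1) + 1 ≟ 2 ^ i)) leaders ×-dec
      allUpTo? (λ p → ¬? (3 ^ l * (3 ^ m * (3 ^ p + 1) + 1) + 1 ≟ 2 ^ i)) 26)) 26)) 26)) 40} _

  check-product : ∀ {i} → i < 40 → 19 ≤ i → ∀ {t} → t < 26 → All (λ (c , f) → ¬ 2 ∣ c → c ≢ 1 → 3 ^ t * c ∣ 2 ^ i ∸ 1 →
    ∀ {a} → a < 6 → ∀ {k} → k < 26 → 3 ^ t * c * (3 ^ k * 2 ^ a + 1) + 1 ≢ 2 ^ i) leaders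
  check-product = toWitness {a? = allUpTo? (λ i → (19 ≤? i) →-dec (allUpTo? (λ t → all? (λ (c , f) → ¬? (2 ∣? c) →-dec (¬? (c ≟ 1) →-dec
    ((3 ^ t * c ∣? 2 ^ i ∸ 1) →-dec allUpTo? (λ a → allUpTo? (λ k →
      ¬? (3 ^ t * c * (3 ^ k * 2 ^ a + 1) + 1 ≟ 2 ^ i)) 26) 6))) leaders) 26)) 40} _

  check-5∙3^k+1 : ∀ {i} → i < 40 → 19 ≤ i → ∀ {k} → k < 26 → 2 * (5 * 3 ^ k + 1) ≢ 2 ^ i
  check-5∙3^k+1 = toWitness {a? = allUpTo? (λ i → (19 ≤? i) →-dec (allUpTo? (λ k → ¬? (2 * (5 * 3 ^ k + 1) ≟ 2 ^ i)) 26)) 40} _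

-- Factorisations of 2 ^ i 3 ^ j

record SmoothFactors (i j x y : ℕ) : Set where
  constructor smoothFactors
  field
    a c p q : ℕ
    x≡  : x ≡ 2 ^ a * 3 ^ c
    y≡  : y ≡ 2 ^ p * 3 ^ q
    a+p : a + p ≡ i
    c+q : c + q ≡ j

opaque
  prime-2 : Prime 2
  prime-2 = toWitness {a? = prime? 2} _

  prime-3 : Prime 3
  prime-3 = toWitness {a? = prime? 3} _

  peel : ∀ {p} .{{_ : NonZero p}} → Prime p → ∀ x y n → x * y ≡ p * n →
    (∃ λ x' → x ≡ p * x' × x' * y ≡ n) ⊎ (∃ λ y' → y ≡ p * y' × x * y' ≡ n)
  peel {p} pp x y n eq with euclidsLemma x y pp (divides n (trans eq (*-comm p n)))
  ... | inj₁ (divides q refl) = inj₁ (q , *-comm q p , *-cancelˡ-≡ (q * y) n p (trans (shuffle p q y) eq))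
    where
    shuffle : ∀ p q y → p * (q * y) ≡ q * p * y
    shuffle = solve-∀
  ... | inj₂ (divides q refl) = inj₂ (q , *-comm q p , *-cancelˡ-≡ (x * q) n p (trans (shuffle p q x) eq))
    where
    shuffle : ∀ p q x → p * (x * q) ≡ x * (q * p)
    shuffle = solve-∀

  smooth-factors : ∀ i j x y → x * y ≡ 2 ^ i * 3 ^ j → SmoothFactors i j x y
  smooth-factors zero zero x y eq =
    smoothFactors 0 0 0 0 (m*n≡1⇒m≡1 x y eq) (m*n≡1⇒n≡1 x y eq) refl refl
  smooth-factors (suc i) j x y eq with peel prime-2 x y (2 ^ i * 3 ^ j) (trans eq (*-assoc 2 (2 ^ i) (3 ^ j)))
  ... | inj₁ (x' , x≡ , eq') with smooth-factors i j x' y eq'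
  ...   | smoothFactors a c p q x'≡ y≡ a+p c+q =
    smoothFactors (suc a) c p q (trans x≡ (trans (cong (2 *_) x'≡) (sym (*-assoc 2 (2 ^ a) (3 ^ c))))) y≡ (cong suc a+p) c+q
  smooth-factors (suc i) j x y eq | inj₂ (y' , y≡ , eq') with smooth-factors i j x y' eq'
  ...   | smoothFactors a c p q x≡ y'≡ a+p c+q =
    smoothFactors a c (suc p) q x≡ (trans y≡ (trans (cong (2 *_) y'≡) (sym (*-assoc 2 (2 ^ p) (3 ^ q)))))
      (trans (+-suc a p) (cong suc a+p)) c+q
  smooth-factors zero (suc j) x y eq with peel prime-3 x y (1 * 3 ^ j) (trans eq (shuffle (3 ^ j)))
    where
    shuffle : ∀ t → 1 * (3 * t) ≡ 3 * (1 * t)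
    shuffle = solve-∀
  ... | inj₁ (x' , x≡ , eq') with smooth-factors zero j x' y eq'
  ...   | smoothFactors a c p q x'≡ y≡ a+p c+q =
    smoothFactors a (suc c) p q (trans x≡ (trans (cong (3 *_) x'≡) (shuffle (2 ^ a) (3 ^ c)))) y≡ a+p (cong suc c+q)
    where
    shuffle : ∀ s t → 3 * (s * t) ≡ s * (3 * t)
    shuffle = solve-∀
  smooth-factors zero (suc j) x y eq | inj₂ (y' , y≡ , eq') with smooth-factors zero j x y' eq'
  ...   | smoothFactors a c p q x≡ y'≡ a+p c+q =
    smoothFactors a c p (suc q) x≡ (trans y≡ (trans (cong (3 *_) y'≡) (shuffle (2 ^ p) (3 ^ q)))) a+p
      (trans (+-suc c q) (cong suc c+q))
    where
    shuffle : ∀ s t → 3 * (s * t) ≡ s * (3 * t)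
    shuffle = solve-∀

-- Consequences of a saved 1

three : Expr
three = add one (add one one)

triple : ℕ → Expr → Expr
triple zero    e = e
triple (suc l) e = mul three (triple l e)

bump : ℕ → Expr → Expr
bump zero    e = e
bump (suc w) e = add one (bump w e)

opaque
  value-triple : ∀ l e → value (triple l e) ≡ 3 ^ l * value e
  value-triple zero    e = sym (+-identityʳ (value e))
  value-triple (suc l) e = trans (cong (3 *_) (value-triple l e)) (sym (*-assoc 3 (3 ^ l) (value e)))

  ones-triple : ∀ l e → ones (triple l e) ≡ ones e + 3 * l
  ones-triple zero    e = sym (+-identityʳ (ones e))
  ones-triple (suc l) e = trans (cong (3 +_) (ones-triple l e)) (shuffle (ones e) l)
    where
    shuffle : ∀ k l → 3 + (k + 3 * l) ≡ k + 3 * (1 + l)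
    shuffle = solve-∀

  value-bump : ∀ w e → value (bump w e) ≡ value e + w
  value-bump zero    e = sym (+-identityʳ (value e))
  value-bump (suc w) e = trans (cong suc (value-bump w e)) (sym (+-suc (value e) w))

  ones-bump : ∀ w e → ones (bump w e) ≡ ones e + w
  ones-bump zero    e = sym (+-identityʳ (ones e))
  ones-bump (suc w) e = trans (cong suc (ones-bump w e)) (sym (+-suc (ones e) w))

  cube-2^3^ : ∀ i J → (2 ^ i * 3 ^ J) ^ 3 ≡ 8 ^ i * 3 ^ (3 * J)
  cube-2^3^ i J = trans (cube-* (2 ^ i) (3 ^ J)) (cong₂ _*_
    (trans (^-*-assoc 2 i 3) (trans (cong (2 ^_) (*-comm i 3)) (sym (^-*-assoc 2 3 i)))) (cube-3^ J))

  -- At 2 i + 3 J ones the ratio is exactly (9/8) ^ i. The saved 1 is kept in `suc K`, so that it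
  -- can later be removed together with a summand.
  deficit-ratio : ∀ I {i} J {K} → i ≤ I → K < 2 * i + 3 * J → Ratio (9 ^ I) (8 ^ I) (suc K) (2 ^ i * 3 ^ J)
  deficit-ratio I {i} J {K} i≤I lt with m≤n⇒∃[o]m+o≡n i≤I
  ... | o , refl = ratio (begin
    8 ^ (i + o) * 3 ^ suc K                      ≤⟨ *-monoʳ-≤ (8 ^ (i + o)) (^-monoʳ-≤ 3 lt) ⟩
    8 ^ (i + o) * 3 ^ (2 * i + 3 * J)            ≡⟨ cong₂ _*_ (^-distribˡ-+-* 8 i o) (trans (^-distribˡ-+-* 3 (2 * i) (3 * J))
                                                      (cong (_* 3 ^ (3 * J)) (sym (^-*-assoc 3 2 i)))) ⟩
    8 ^ i * 8 ^ o * (9 ^ i * 3 ^ (3 * J))        ≤⟨ *-monoˡ-≤ (9 ^ i * 3 ^ (3 * J)) (*-monoʳ-≤ (8 ^ i) (^-monoˡ-≤ o (n≤1+n 8))) ⟩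
    8 ^ i * 9 ^ o * (9 ^ i * 3 ^ (3 * J))        ≡⟨ shuffle (8 ^ i) (9 ^ o) (9 ^ i) (3 ^ (3 * J)) ⟩
    9 ^ i * 9 ^ o * (8 ^ i * 3 ^ (3 * J))        ≡⟨ cong₂ _*_ (^-distribˡ-+-* 9 i o) (cube-2^3^ i J) ⟨
    9 ^ (i + o) * (2 ^ i * 3 ^ J) ^ 3            ∎)
    where
    shuffle : ∀ a b c d → a * b * (c * d) ≡ c * b * (a * d)
    shuffle = solve-∀

  -- A saved 1 requires (9/8) ^ i ≥ 3, while (9/8)⁹ < 3.
  deficit-exponent : ∀ e {i} J → value e ≡ 2 ^ i * 3 ^ J → ones e < 2 * i + 3 * J → 10 ≤ i
  deficit-exponent e {i} J e≡ lt with 10 ≤? i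
  ... | yes p = p
  ... | no ¬p = contradiction
    (ratio-lower-by 1 3 (value-pos e) (coratio
      (≤-trans (*-monoʳ-≤ 3 (cube≤3^ones e)) (≤-reflexive (sym (*-identityˡ (3 ^ suc (ones e)))))))
      (subst (Ratio (9 ^ i) (8 ^ i) (suc (ones e))) (sym e≡) (deficit-ratio i J ≤-refl lt)))
    (toWitness {a? = allUpTo? (λ i → ¬? (8 ^ i * 3 ≤? 1 * 9 ^ i)) 10} _ (≰⇒> ¬p))

  shifted-exponent : ∀ e {i} J l w → 3 ^ l * value e + w ≡ 2 ^ i * 3 ^ J → ones e + 3 * l + w < 2 * i + 3 * J → 10 ≤ i
  shifted-exponent e J l w eq lt = deficit-exponent (bump w (triple l e)) J
    (trans (value-bump w (triple l e)) (trans (cong (_+ w) (value-triple l e)) eq))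
    (subst (_< _) (sym (trans (ones-bump w (triple l e)) (cong (_+ w) (ones-triple l e)))) lt)

  -- The summand w is removed at the price of w + 1 ones, its own and the saved one. The bound is
  -- (9/8) ^ I (1 + w / t)³ / 3 ^ (w + 1), with t a lower bound for what remains.
  shifted-ratio : ∀ e I {i} J l w t → i ≤ I → 3 ^ l * value e + w ≡ 2 ^ i * 3 ^ J →
    ones e + 3 * l + w < 2 * i + 3 * J → t ≤ 3 ^ l * value e →
    Ratio (9 ^ I * (t + w) ^ 3) (8 ^ I * t ^ 3 * 3 ^ suc w) (ones e) (value e)
  shifted-ratio e I {i} J l w t i≤I eq lt t≤ = leader-ratio (leader l refl ≤-refl)
    (ratio-summand (ones e + 3 * l) (suc w) (3 ^ l * value e) w t w (suc w) ≤-refl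
      (≤-trans (*-monoˡ-≤ w t≤) (≤-reflexive (*-comm (3 ^ l * value e) w)))
      (subst₂ (Ratio (9 ^ I) (8 ^ I)) (sym (+-suc (ones e + 3 * l) w)) (sym eq) (deficit-ratio I J i≤I lt)))

  2^≤smooth : ∀ k {i} J → k ≤ i → 2 ^ k ≤ 2 ^ i * 3 ^ J
  2^≤smooth k {i} J k≤i = ≤-trans (^-monoʳ-≤ 2 k≤i) (m≤m*n (2 ^ i) (3 ^ J) {{m^n≢0 3 J}})

  2^∣smooth : ∀ k {i} J → k ≤ i → 2 ^ k ∣ 2 ^ i * 3 ^ J
  2^∣smooth k {i} J k≤i with m≤n⇒∃[o]m+o≡n k≤i
  ... | o , refl = ∣m⇒∣m*n (3 ^ J) (subst (2 ^ k ∣_) (sym (^-distribˡ-+-* 2 k o)) (m∣m*n (2 ^ o)))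

  3∣shift : ∀ l x w i J → 3 ^ suc l * x + w ≡ 2 ^ i * 3 ^ suc J → 3 ∣ w
  3∣shift l x w i J eq = ∣m+n∣m⇒∣n
    (subst (3 ∣_) (sym eq) (∣n⇒∣m*n (2 ^ i) (m∣m*n (3 ^ J)))) (∣m⇒∣m*n x (m∣m*n (3 ^ l)))

  3^-exponent : ∀ t x w {i} → 1 ≤ x → i ≤ 39 → 3 ^ t * x + w ≡ 2 ^ i → t < 26
  3^-exponent t x w {i} x≥1 i≤39 eq = 3^-cancel-< t 26 (≤-<-trans (begin
    3 ^ t            ≤⟨ m≤m*n (3 ^ t) x {{>-nonZero x≥1}} ⟩
    3 ^ t * x        ≤⟨ m≤m+n (3 ^ t * x) w ⟩
    3 ^ t * x + w    ≡⟨ eq ⟩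
    2 ^ i            ≤⟨ ^-monoʳ-≤ 2 i≤39 ⟩
    2 ^ 39           ∎) by-≤?)

  ∣shift : ∀ m x w i → m * x + w ≡ 2 ^ i → m ∣ 2 ^ i ∸ w
  ∣shift m x w i eq = divides x (trans (cong (_∸ w) (sym eq)) (trans (m+n∸n≡m (m * x) w) (*-comm m x)))

-- The induction moves powers of 3 into l and small summands into w.  It stays within w ≤ 3 because an expression
-- saving one 1 on 2 ^ i * 3 ^ J with i ≤ 39 has ratio at most (9/8)³⁹ / 3 < 3 ^ 4.
Shifted : Expr → Set
Shifted e = ∀ i J l w → i ≤ 39 → 1 ≤ w → w ≤ 3 → 3 ^ l * value e + w ≡ 2 ^ i * 3 ^ J →
  2 * i + 3 * J ≤ ones e + 3 * l + w

opaque
  minuend-≥ : ∀ k t w {x i} J → k ≤ i → x + w ≡ 2 ^ i * 3 ^ J → t + w ≤ 2 ^ k → t ≤ x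
  minuend-≥ k t w {x} J k≤i eq le =
    +-cancelʳ-≤ w t x (≤-trans le (≤-trans (2^≤smooth k J k≤i) (≤-reflexive (sym eq))))

  value≤ones : ∀ e → ones e ≤ 3 → value e ≤ ones e
  value≤ones e le = go (ones e) refl le
    where
    go : ∀ k → ones e ≡ k → k ≤ 3 → value e ≤ k
    go 0 eq _ = contradiction (subst (1 ≤_) eq (ones-pos e)) λ ()
    go 1 eq _ = ≤-pred (value-< e 1 2 (≤-reflexive eq) by-≤?)
    go 2 eq _ = ≤-pred (value-< e 2 3 (≤-reflexive eq) by-≤?)
    go 3 eq _ = ≤-pred (value-< e 3 4 (≤-reflexive eq) by-≤?)
    go (suc (suc (suc (suc _)))) _ (s≤s (s≤s (s≤s ())))

  -- If a 1 is saved, d and w together cost at most 3 ones, so d has at most as many units as ones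
  -- and can join w.
  absorb : ∀ e d i J w → i ≤ 39 → w ≤ 2 → value d ≤ value e → Shifted e →
    value e + value d + w ≡ 2 ^ i * 3 ^ J → 2 * i + 3 * J ≤ ones e + ones d + w
  absorb e d i J w i≤39 w≤2 d≤e shifted eq = ≮⇒≥ λ short → <⇒≱ short (bound′ short)
    where
    bound′ : ones e + ones d + w < 2 * i + 3 * J → 2 * i + 3 * J ≤ ones e + ones d + w
    bound′ short = begin
      2 * i + 3 * J                     ≤⟨ shifted i J 0 (value d + w) i≤39 (≤-trans (value-pos d) (m≤m+n _ w))
                                             (≤-trans (+-monoˡ-≤ w d≤ones) ones+w≤3) eq′ ⟩
      ones e + 0 + (value d + w)        ≡⟨ cong (_+ (value d + w)) (+-identityʳ (ones e)) ⟩
      ones e + (value d + w)            ≤⟨ +-monoʳ-≤ (ones e) (+-monoˡ-≤ w d≤ones) ⟩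
      ones e + (ones d + w)             ≡⟨ +-assoc (ones e) (ones d) w ⟨
      ones e + ones d + w               ∎
      where
      i≥10 : 10 ≤ i
      i≥10 = deficit-exponent (bump w (add e d)) J (trans (value-bump w (add e d)) eq)
               (subst (_< 2 * i + 3 * J) (sym (ones-bump w (add e d))) short)
      r : Ratio (9 ^ 39) (8 ^ 39) (ones e + suc (ones d + w)) (value e + (value d + w))
      r = subst₂ (Ratio (9 ^ 39) (8 ^ 39))
            (trans (cong suc (+-assoc (ones e) (ones d) w)) (sym (+-suc (ones e) (ones d + w))))
            (trans (sym eq) (+-assoc (value e) (value d) w)) (deficit-ratio 39 J i≤39 short)
      2e+2≥1024 : 1024 ≤ value e + value e + 2
      2e+2≥1024 = begin
        1024                       ≤⟨ 2^≤smooth 10 J i≥10 ⟩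
        2 ^ i * 3 ^ J              ≡⟨ eq ⟨
        value e + value d + w      ≤⟨ +-mono-≤ (+-monoʳ-≤ (value e) d≤e) w≤2 ⟩
        value e + value e + 2      ∎
      e≥2 : 2 ≤ value e
      e≥2 = ≮⇒≥ λ e<2 → contradiction (≤-trans 2e+2≥1024 (+-monoˡ-≤ 2 (+-mono-≤ (≤-pred e<2) (≤-pred e<2)))) by-≰?
      -- A first, crude bound: only d + w ≤ 2 e is known, hence the factor 3³, and 27 (9/8)³⁹ < 3⁸.
      ones+w≤6 : ones d + w ≤ 6
      ones+w≤6 = ≤-pred (≤-pred (smaller-summand-< e (suc (ones d + w)) (value d + w) 1 2 8
        (≤-trans (≤-reflexive (*-identityˡ _)) (+-mono-≤ d≤e
          (≤-trans w≤2 (≤-trans e≥2 (≤-reflexive (sym (*-identityˡ (value e)))))))) by-≰? r))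
      d+w≤11 : value d + w ≤ 11
      d+w≤11 = +-mono-≤ (≤-pred (value-< d 6 10 (≤-trans (m≤m+n (ones d) w) ones+w≤6) by-≤?)) w≤2
      e≥1000 : 1000 ≤ value e
      e≥1000 = +-cancelʳ-≤ 11 1000 (value e) (begin
        1011                       ≤⟨ by-≤? ⟩
        1024                       ≤⟨ 2^≤smooth 10 J i≥10 ⟩
        2 ^ i * 3 ^ J              ≡⟨ eq ⟨
        value e + value d + w      ≡⟨ +-assoc (value e) (value d) w ⟩
        value e + (value d + w)    ≤⟨ +-monoʳ-≤ (value e) d+w≤11 ⟩
        value e + 11               ∎)
      -- Now that e ≥ 1000 and d + w ≤ 11 the factor is only (1011/1000)³, and its product with
      -- (9/8)³⁹ is below 3⁵.
      ones+w≤3 : ones d + w ≤ 3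
      ones+w≤3 = ≤-pred (≤-pred (smaller-summand-< e (suc (ones d + w)) (value d + w) 1000 11 5
        (≤-trans (*-mono-≤ e≥1000 d+w≤11) (≤-reflexive (*-comm (value e) 11))) by-≰? r))
      d≤ones : value d ≤ ones d
      d≤ones = value≤ones d (≤-trans (m≤m+n (ones d) w) ones+w≤3)
      eq′ : 1 * value e + (value d + w) ≡ 2 ^ i * 3 ^ J
      eq′ = trans (cong (_+ (value d + w)) (*-identityˡ (value e))) (trans (sym (+-assoc (value e) (value d) w)) eq)

  2∤3^ : ∀ m → ¬ 2 ∣ 3 ^ m
  2∤3^ m 2∣ = by-∤? (∣m+n∣m⇒∣n (2∣3^+1 m) 2∣)

  classify-smooth-<2 : ∀ e → Defect≤ 5 4 e → ∃ λ a → a < 2 × Leader (2 ^ a) (2 * a) (ones e) (value e)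
  classify-smooth-<2 e r = go (classify-smooth e (weaken 97 50 by-≤? r))
    where
    go : Smooth (ones e) (value e) → ∃ λ a → a < 2 × Leader (2 ^ a) (2 * a) (ones e) (value e)
    go (a , a<6 , L) = a , smooth-exponent-<2 a<6 (leader-ratio L r) , L

  -- The remaining ratio is below 5/4 < (9/8)², so `e` is 3 ^ k or 2 · 3 ^ k. The first fails modulo
  -- 8, the second modulo 2.
  shift≢3 : ∀ e i J l → i ≤ 39 → 3 ^ l * value e + 3 ≡ 2 ^ i * 3 ^ J → ¬ ones e + 3 * l + 3 < 2 * i + 3 * J
  shift≢3 e i J l i≤39 eq short = go (classify-smooth-<2 e (weaken 5 4 by-≤?
      (shifted-ratio e 39 J l 3 1000 i≤39 eq short (minuend-≥ 10 1000 3 J i≥10 eq by-≤?))))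
    where
    i≥10 : 10 ≤ i
    i≥10 = shifted-exponent e J l 3 eq short
    go : ¬ (∃ λ a → a < 2 × Leader (2 ^ a) (2 * a) (ones e) (value e))
    go (0 , _ , leader k e≡ _) = 8∤3^+ (l + k) {3} by-≤? (subst (8 ∣_) (trans (sym eq) (cong (_+ 3)
      (trans (cong (3 ^ l *_) e≡) (trans (3^-*-assoc l k 1) (*-identityʳ (3 ^ (l + k))))))) (2^∣smooth 3 J (≤-trans by-≤? i≥10)))
    go (1 , _ , leader k e≡ _) = by-∤? (∣m+n∣m⇒∣n
      (subst (2 ∣_) (sym eq) (2^∣smooth 1 J (≤-trans by-≤? i≥10)))
      (∣n⇒∣m*n (3 ^ l) (subst (2 ∣_) (sym e≡) (∣n⇒∣m*n (3 ^ k) ∣-refl))))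
    go (suc (suc _) , s≤s (s≤s ()) , _)

-- The remainder w = 2

opaque
  scale-≤ : ∀ q s {u v} → q ≤ u → v ≤ s → q * v ≤ s * u
  scale-≤ q s {u} {v} q≤u v≤s = ≤-trans (*-mono-≤ q≤u v≤s) (≤-reflexive (*-comm u s))

  odd-pos : ∀ {c} → ¬ 2 ∣ c → 1 ≤ c
  odd-pos {zero}  odd = contradiction (divides 0 refl) odd
  odd-pos {suc c} odd = s≤s z≤n

  3^t∙2c+2≢ : ∀ t {c f} i J → (c , f) ∈ leaders → ¬ 2 ∣ c → 10 ≤ i → i ≤ 39 → 3 ^ t * (2 * c) + 2 ≢ 2 ^ i * 3 ^ J
  3^t∙2c+2≢ t {c} i zero c∈ odd i≥10 i≤39 eq =
    lookup (check-3^t∙2c+2 (s≤s i≤39) i≥10 (3^-exponent t (2 * c) 2 (*-mono-≤ {1} {2} by-≤? (odd-pos odd)) i≤39 eq′)) c∈ odd eq′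
    where
    eq′ : 3 ^ t * (2 * c) + 2 ≡ 2 ^ i
    eq′ = trans eq (*-identityʳ (2 ^ i))
  3^t∙2c+2≢ (suc t) {c} i (suc J) _ _ _ _ eq = by-∤? (3∣shift t (2 * c) 2 i J eq)
  3^t∙2c+2≢ zero {c} i (suc J) c∈ odd i≥10 _ eq = contradiction (begin
    1024                     ≤⟨ 2^≤smooth 10 (suc J) i≥10 ⟩
    2 ^ i * 3 ^ suc J        ≡⟨ eq ⟨
    1 * (2 * c) + 2          ≤⟨ +-monoˡ-≤ 2 (*-monoʳ-≤ 1 (*-monoʳ-≤ 2 (odd-leader-≤ c∈ odd))) ⟩
    328                      ∎) by-≰?

  -- The product is 2 modulo 4, so the smooth factor is 3 ^ k or 2 · 3 ^ k. The first moves into l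
  -- and leaves the claim for `d`. The second makes `d` odd with ratio at most (369/100) (8/9) <
  -- 83/25, hence listed.
  shift≢2-mul : ∀ e d i J l → i ≤ 39 → 10 ≤ i → Smooth (ones e) (value e) → Shifted d → Defect≤ 369 100 (mul e d) →
    3 ^ l * (value e * value d) + 2 ≡ 2 ^ i * 3 ^ J → ¬ ones e + ones d + 3 * l + 2 < 2 * i + 3 * J
  shift≢2-mul e d i J l i≤39 i≥10 (a , a<6 , L@(leader k e≡ cost)) IH r eq short = go a a<6 L e≡ cost
    where
    4∣N : 4 ∣ 2 ^ i * 3 ^ J
    4∣N = 2^∣smooth 2 J (≤-trans by-≤? i≥10)
    4∤ : ¬ 4 ∣ 3 ^ l * (value e * value d)
    4∤ 4∣ = by-∤? (∣m+n∣m⇒∣n (subst (4 ∣_) (sym eq) 4∣N) 4∣)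
    go : ∀ a → a < 6 → Leader (2 ^ a) (2 * a) (ones e) (value e) → value e ≡ 3 ^ k * 2 ^ a → ¬ 2 * a + 3 * k ≤ ones e
    go 0 _ _ e≡ cost = <⇒≱ short (begin
      2 * i + 3 * J                     ≤⟨ IH i J (l + k) 2 i≤39 by-≤? by-≤? (trans (cong (_+ 2) shift) eq) ⟩
      ones d + 3 * (l + k) + 2          ≡⟨ shuffle (ones d) l k ⟩
      3 * k + ones d + 3 * l + 2        ≤⟨ +-monoˡ-≤ 2 (+-monoˡ-≤ (3 * l) (+-monoˡ-≤ (ones d) cost)) ⟩
      ones e + ones d + 3 * l + 2       ∎)
      where
      shuffle : ∀ d l k → d + 3 * (l + k) + 2 ≡ 3 * k + d + 3 * l + 2
      shuffle = solve-∀
      shift : 3 ^ (l + k) * value d ≡ 3 ^ l * (value e * value d)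
      shift = trans (sym (3^-*-assoc l k (value d)))
        (cong (λ x → 3 ^ l * (x * value d)) (sym (trans e≡ (*-identityʳ (3 ^ k)))))
    go 1 _ L e≡ cost = by-leader (classify d (weaken 83 25 by-≤?
        (ratio-quotient (ones e) (ones d) (value e) (value d) 8 9 (value-pos e) (leader-coratio (2³<3² {0} by-≤?) L) r)))
      where
      oddᵈ : ¬ 2 ∣ value d
      oddᵈ (divides x d≡) = 4∤ (divides (3 ^ l * (3 ^ k * x))
        (trans (cong₂ (λ y z → 3 ^ l * (y * z)) e≡ d≡) (shuffle (3 ^ l) (3 ^ k) x)))
        where
        shuffle : ∀ a b x → a * (b * 2 * (x * 2)) ≡ a * (b * x) * 4
        shuffle = solve-∀
      by-leader : ¬ (Listed (ones d) (value d) ⊎ Near3^ (ones d) (value d))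
      by-leader (inj₂ near) = odd⇒¬near3^ oddᵈ near
      by-leader (inj₁ (c , f , c∈ , L'@(leader q d≡ _))) = 3^t∙2c+2≢ (l + (k + q)) i J c∈ (leader-odd oddᵈ L') i≥10 i≤39
        (trans (cong (_+ 2) shift) eq)
        where
        shuffle : ∀ a b x c → a * (b * x * (2 * c)) ≡ a * (b * 2 * (x * c))
        shuffle = solve-∀
        shift : 3 ^ (l + (k + q)) * (2 * c) ≡ 3 ^ l * (value e * value d)
        shift = trans (sym (3^-*-assoc l (k + q) (2 * c))) (trans (cong (λ y → 3 ^ l * (y * (2 * c))) (^-distribˡ-+-* 3 k q))
          (trans (shuffle (3 ^ l) (3 ^ k) (3 ^ q) c) (sym (cong₂ (λ y z → 3 ^ l * (y * z)) e≡ d≡))))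
    go (suc (suc a)) _ _ e≡ _ = 4∤ (∣n⇒∣m*n (3 ^ l) (∣m⇒∣m*n (value d) (subst (4 ∣_) (sym e≡)
      (∣n⇒∣m*n (3 ^ k) (divides (2 ^ a) (shuffle (2 ^ a)))))))
      where
      shuffle : ∀ x → 2 * (2 * x) ≡ x * 4
      shuffle = solve-∀

  -- The factor 3 ^ `suc l` and 3 ∤ 2 force J = 0. Then 3 ^ `suc l` divides 2 ^ i - 2, so the sum is
  -- large, d = 1, and `e` is 3 ^ k or 2 · 3 ^ k.
  shift≢2-add : ∀ e d i J l → i ≤ 39 → 10 ≤ i → value d ≤ value e → Defect≤ 369 100 (add e d) →
    3 ^ suc l * (value e + value d) + 2 ≢ 2 ^ i * 3 ^ J
  shift≢2-add e d i (suc J) l _ _ _ _ eq = by-∤? (3∣shift l (value e + value d) 2 i J eq)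
  shift≢2-add e d i zero l i≤39 i≥10 d≤e r eq = go (classify-smooth-<2 e (weaken 5 4 by-≤?
      (ratio-summand (ones e) (ones d) (value e) (value d) 590 3 1 (ones-pos d) 590d≤3e r)))
    where
    eq′ : 3 ^ suc l * (value e + value d) + 2 ≡ 2 ^ i
    eq′ = trans eq (*-identityʳ (2 ^ i))
    checked : 600 * 3 ^ suc l + 2 ≤ 2 ^ i × (∀ {k} → k < 26 → 3 ^ suc l * (3 ^ k + 1) + 2 ≢ 2 ^ i)
    checked = check-3^l∙[3^k+1]+2 (s≤s i≤39) i≥10 (3^-exponent (suc l) (value e + value d) 2 (value-pos (add e d)) i≤39 eq′)
      (s≤s z≤n) (∣shift (3 ^ suc l) (value e + value d) 2 i eq′)
    n≥600 : 600 ≤ value e + value d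
    n≥600 = *-cancelˡ-≤ (3 ^ suc l) {{m^n≢0 3 (suc l)}} (≤-trans (≤-reflexive (*-comm (3 ^ suc l) 600))
      (+-cancelʳ-≤ 2 _ _ (≤-trans (proj₁ checked) (≤-reflexive (sym eq′)))))
    d<4 : value d < 4
    d<4 = value-< d 3 4 (≤-pred (smaller-summand-< e (ones d) (value d) 1 1 4 (*-monoʳ-≤ 1 d≤e) by-≰? r)) by-≤?
    -- 590 is just large enough for (369/100) (593/590)³ / 3 ≤ 5/4, and the sum of at least 600 with
    -- d < 4 supplies it.
    590d≤3e : 590 * value d ≤ 3 * value e
    590d≤3e = scale-≤ 590 3 (+-cancelʳ-≤ 4 590 (value e) (≤-trans by-≤? (≤-trans n≥600 (+-monoʳ-≤ (value e) (<⇒≤ d<4))))) (≤-pred d<4)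
    d≡1 : value d ≡ 1
    d≡1 = ≤-antisym (≤-pred (value-< d 1 2 (≤-pred
      (smaller-summand-< e (ones d) (value d) 590 3 2 590d≤3e by-≰? r)) by-≤?)) (value-pos d)
    go : ¬ (∃ λ a → a < 2 × Leader (2 ^ a) (2 * a) (ones e) (value e))
    go (0 , _ , leader k e≡ _) = proj₂ checked (3^-exponent k (3 ^ suc l) (3 ^ suc l + 2) (m^n>0 3 (suc l)) i≤39
        (trans (shuffle (3 ^ k) (3 ^ suc l)) eq″)) eq″
      where
      shuffle : ∀ x y → x * y + (y + 2) ≡ y * (x + 1) + 2
      shuffle = solve-∀
      eq″ : 3 ^ suc l * (3 ^ k + 1) + 2 ≡ 2 ^ i
      eq″ = trans (cong (λ n → 3 ^ suc l * n + 2) (sym (cong₂ _+_ (trans e≡ (*-identityʳ (3 ^ k))) d≡1))) eq′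
    go (1 , _ , leader k e≡ _) = 2∤3^ (suc l) (∣m+n∣m⇒∣n (subst (2 ∣_)
        (trans (sym eq′) (trans (cong (λ n → 3 ^ suc l * n + 2) (cong₂ _+_ e≡ d≡1)) (shuffle (3 ^ k) (3 ^ suc l))))
        (subst (2 ∣_) (*-identityʳ (2 ^ i)) (2^∣smooth 1 0 (≤-trans by-≤? i≥10))))
        (m∣m*n (3 ^ suc l * 3 ^ k + 1)))
      where
      shuffle : ∀ x y → y * (x * 2 + 1) + 2 ≡ 2 * (y * x + 1) + y
      shuffle = solve-∀
    go (suc (suc _) , s≤s (s≤s ()) , _)

-- The remainder w = 1

opaque
  leader-5 : ∀ {c f} → (c , f) ∈ leaders → ¬ 2 ∣ c → 3 ∣ c + 1 → c ≡ 5
  leader-5 = lookup (toWitness {a? = all? (λ (c , f) → ¬? (2 ∣? c) →-dec ((3 ∣? c + 1) →-dec (c ≟ 5))) leaders} _)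

  -- Modulo 3, t or J is 0. With J = 0 the divisor 3 ^ t of 2 ^ i - 1 is too small for so small a
  -- cofactor; with t = 0 the left side is below 2 ^ 19.
  3^t∙c+1≢ : ∀ t {c} i J → 1 ≤ c → c ≤ 195600 → 19 ≤ i → i ≤ 39 → 3 ^ t * c + 1 ≢ 2 ^ i * 3 ^ J
  3^t∙c+1≢ t {c} i zero c≥1 c≤ i≥19 i≤39 eq = <⇒≱ (check-size (s≤s i≤39) i≥19
      (3^-exponent t c 1 c≥1 i≤39 eq′) (∣shift (3 ^ t) c 1 i eq′)) (begin
    2 ^ i                    ≡⟨ eq′ ⟨
    3 ^ t * c + 1            ≤⟨ +-monoˡ-≤ 1 (≤-trans (*-monoʳ-≤ (3 ^ t) c≤) (≤-reflexive (*-comm (3 ^ t) 195600))) ⟩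
    195600 * 3 ^ t + 1       ∎)
    where
    eq′ : 3 ^ t * c + 1 ≡ 2 ^ i
    eq′ = trans eq (*-identityʳ (2 ^ i))
  3^t∙c+1≢ (suc t) {c} i (suc J) _ _ _ _ eq = by-∤? (3∣shift t c 1 i J eq)
  3^t∙c+1≢ zero {c} i (suc J) _ c≤ i≥19 _ eq = contradiction (begin
    2 ^ 19                   ≤⟨ 2^≤smooth 19 (suc J) i≥19 ⟩
    2 ^ i * 3 ^ suc J        ≡⟨ eq ⟨
    1 * c + 1                ≤⟨ +-monoˡ-≤ 1 (*-monoʳ-≤ 1 c≤) ⟩
    195601                   ∎) by-≰?

  -- Divisibility by 4 leaves a = 1. Cancelling a factor 3 then gives 2 (5 · 3 ^ k + 1) = 2 ^ i 3 ^
  -- J, where k or J is 0 modulo 3 again.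
  5[3^k∙2^a+1]+1≢ : ∀ a k i J → 19 ≤ i → i ≤ 39 → 5 * (3 ^ suc k * 2 ^ a + 1) + 1 ≢ 2 ^ i * 3 ^ suc J
  5[3^k∙2^a+1]+1≢ 0 k i J i≥19 _ eq = 2∤3^ (suc k) (∣m+n∣m⇒∣n
    (subst (2 ∣_) (trans (sym eq) (shuffle (3 ^ suc k))) (2^∣smooth 1 (suc J) (≤-trans by-≤? i≥19))) (m∣m*n (2 * 3 ^ suc k + 3)))
    where
    shuffle : ∀ x → 5 * (x * 1 + 1) + 1 ≡ 2 * (2 * x + 3) + x
    shuffle = solve-∀
  5[3^k∙2^a+1]+1≢ (suc (suc a)) k i J i≥19 _ eq = by-∤? {4} {6} (∣m+n∣m⇒∣n
    (subst (4 ∣_) (trans (sym eq) (shuffle (3 ^ suc k) (2 ^ a))) (2^∣smooth 2 (suc J) (≤-trans by-≤? i≥19)))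
    (m∣m*n (5 * 3 ^ suc k * 2 ^ a)))
    where
    shuffle : ∀ x y → 5 * (x * (2 * (2 * y)) + 1) + 1 ≡ 4 * (5 * x * y) + 6
    shuffle = solve-∀
  5[3^k∙2^a+1]+1≢ 1 k i J i≥19 i≤39 eq = go k J (*-cancelˡ-≡ _ _ 3
      (trans (shuffle (3 ^ k)) (trans eq (shuffle′ (2 ^ i) (3 ^ J)))))
    where
    shuffle : ∀ x → 3 * (2 * (5 * x + 1)) ≡ 5 * (3 * x * 2 + 1) + 1
    shuffle = solve-∀
    shuffle′ : ∀ x y → x * (3 * y) ≡ 3 * (x * y)
    shuffle′ = solve-∀
    go : ∀ k J → 2 * (5 * 3 ^ k + 1) ≢ 2 ^ i * 3 ^ J
    go k zero eq = check-5∙3^k+1 (s≤s i≤39) i≥19 (3^-exponent k 10 2 by-≤? i≤39 (trans (shuffle₂ (3 ^ k)) eq′)) eq′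
      where
      shuffle₂ : ∀ x → x * 10 + 2 ≡ 2 * (5 * x + 1)
      shuffle₂ = solve-∀
      eq′ : 2 * (5 * 3 ^ k + 1) ≡ 2 ^ i
      eq′ = trans eq (*-identityʳ (2 ^ i))
    go zero (suc J) eq = contradiction (≤-trans (2^≤smooth 19 (suc J) i≥19) (≤-reflexive (sym eq))) by-≰?
    go (suc k) (suc J) eq = by-∤? (3∣shift k 10 2 i J (trans (shuffle₂ (3 ^ suc k)) eq))
      where
      shuffle₂ : ∀ x → x * 10 + 2 ≡ 2 * (5 * x + 1)
      shuffle₂ = solve-∀

  -- J = 0 is a finite search. For J > 0 the equation modulo 3 gives t = 0, and, unless k = 0 makes
  -- the left side too small, c ≡ 2; the only odd leader with this residue is 5.
  3^t∙c∙[3^k∙2^a+1]+1≢ : ∀ t {c f} k a i J → (c , f) ∈ leaders → ¬ 2 ∣ c → c ≢ 1 → a < 6 → 19 ≤ i → i ≤ 39 →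
    3 ^ t * c * (3 ^ k * 2 ^ a + 1) + 1 ≢ 2 ^ i * 3 ^ J
  3^t∙c∙[3^k∙2^a+1]+1≢ t {c} k a i zero c∈ odd c≢1 a<6 i≥19 i≤39 eq =
    lookup (check-product (s≤s i≤39) i≥19
      (3^-exponent t (c * (3 ^ k * 2 ^ a + 1)) 1 (*-mono-≤ (odd-pos odd) (m≤n+m 1 (3 ^ k * 2 ^ a))) i≤39
        (trans (cong (_+ 1) (sym (*-assoc (3 ^ t) c (3 ^ k * 2 ^ a + 1)))) eq′)))
      c∈ odd c≢1 (∣shift (3 ^ t * c) (3 ^ k * 2 ^ a + 1) 1 i eq′) a<6
      (3^-exponent k (3 ^ t * c * 2 ^ a) (3 ^ t * c + 1)
        (*-mono-≤ (*-mono-≤ (m^n>0 3 t) (odd-pos odd)) (m^n>0 2 a)) i≤39 (trans (shuffle (3 ^ k) (3 ^ t * c) (2 ^ a)) eq′)) eq′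
    where
    shuffle : ∀ x y z → x * (y * z) + (y + 1) ≡ y * (x * z + 1) + 1
    shuffle = solve-∀
    eq′ : 3 ^ t * c * (3 ^ k * 2 ^ a + 1) + 1 ≡ 2 ^ i
    eq′ = trans eq (*-identityʳ (2 ^ i))
  3^t∙c∙[3^k∙2^a+1]+1≢ (suc t) {c} k a i (suc J) _ _ _ _ _ _ eq = by-∤? (3∣shift t (c * (3 ^ k * 2 ^ a + 1)) 1 i J
    (trans (cong (_+ 1) (sym (*-assoc (3 ^ suc t) c (3 ^ k * 2 ^ a + 1)))) eq))
  3^t∙c∙[3^k∙2^a+1]+1≢ zero {c} zero a i (suc J) c∈ odd _ a<6 i≥19 _ eq = contradiction (begin
    2 ^ 19                          ≤⟨ 2^≤smooth 19 (suc J) i≥19 ⟩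
    2 ^ i * 3 ^ suc J               ≡⟨ eq ⟨
    1 * c * (1 * 2 ^ a + 1) + 1     ≤⟨ +-monoˡ-≤ 1 (*-mono-≤ (*-monoʳ-≤ 1 (odd-leader-≤ c∈ odd))
                                         (+-monoˡ-≤ 1 (*-monoʳ-≤ 1 (^-monoʳ-≤ 2 (≤-pred a<6))))) ⟩
    163 * 33 + 1                    ∎) by-≰?
  3^t∙c∙[3^k∙2^a+1]+1≢ zero {c} (suc k) a i (suc J) c∈ odd _ _ i≥19 i≤39 eq =
    five (leader-5 c∈ odd (∣m+n∣m⇒∣n (subst (3 ∣_) (trans (sym eq) (shuffle c (3 ^ k) (2 ^ a)))
      (∣n⇒∣m*n (2 ^ i) (m∣m*n (3 ^ J)))) (m∣m*n (c * (3 ^ k * 2 ^ a))))) eq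
    where
    shuffle : ∀ c x y → 1 * c * (3 * x * y + 1) + 1 ≡ 3 * (c * (x * y)) + (c + 1)
    shuffle = solve-∀
    five : ∀ {c} → c ≡ 5 → 1 * c * (3 ^ suc k * 2 ^ a + 1) + 1 ≢ 2 ^ i * 3 ^ suc J
    five refl = 5[3^k∙2^a+1]+1≢ a k i J i≥19 i≤39

  -- The summand 1 and the saved 1 divide the ratio by 9, and (9/8)¹⁸ < 9, even after the correction
  -- (1001/1000)³.
  shift≢1-exponent : ∀ e {i} J l → 10 ≤ i → 3 ^ l * value e + 1 ≡ 2 ^ i * 3 ^ J → ones e + 3 * l + 1 < 2 * i + 3 * J → 19 ≤ i
  shift≢1-exponent e {i} J l i≥10 eq short with 19 ≤? i
  ... | yes p = p
  ... | no ¬p = contradiction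
    (ratio-lower (value-pos e) (cube≤3^ones e) (shifted-ratio e i J l 1 1000 ≤-refl eq short (minuend-≥ 10 1000 1 J i≥10 eq by-≤?)))
    (toWitness {a? = allUpTo? (λ i → ¬? (8 ^ i * 1000 ^ 3 * 3 ^ 2 ≤? 9 ^ i * 1001 ^ 3)) 19} _ (≰⇒> ¬p))

  -- Both factors are odd, which rules out `Near3^`. If `e` is a power of 3 it moves into l.
  -- Otherwise its ratio is at least 243/125, and (1099/100) (125/243) < 283/50 brings `d` within
  -- reach of `classify-odd`.
  shift≢1-mul : ∀ e d i J l → i ≤ 39 → 19 ≤ i → Defect≤ 83 25 e → Shifted d → Defect≤ 1099 100 (mul e d) →
    3 ^ l * (value e * value d) + 1 ≡ 2 ^ i * 3 ^ J → ¬ ones e + ones d + 3 * l + 1 < 2 * i + 3 * J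
  shift≢1-mul e d i J l i≤39 i≥19 rₑ IH r eq short = by-leader (classify e rₑ)
    where
    2∤ : ¬ 2 ∣ value e * value d
    2∤ 2∣ = by-∤? (∣m+n∣m⇒∣n (subst (2 ∣_) (sym eq) (2^∣smooth 1 J (≤-trans by-≤? i≥19))) (∣n⇒∣m*n (3 ^ l) 2∣))
    oddₑ : ¬ 2 ∣ value e
    oddₑ 2∣ = 2∤ (∣m⇒∣m*n (value d) 2∣)
    oddᵈ : ¬ 2 ∣ value d
    oddᵈ 2∣ = 2∤ (∣n⇒∣m*n (value e) 2∣)
    by-leader : ¬ (Listed (ones e) (value e) ⊎ Near3^ (ones e) (value e))
    by-leader (inj₂ near) = odd⇒¬near3^ oddₑ near
    by-leader (inj₁ (c , f , c∈ , L@(leader k e≡ cost))) = split (c ≟ 1)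
      where
      trivial : c ≡ 1 → ⊥
      trivial c≡1 = <⇒≱ short (begin
        2 * i + 3 * J                     ≤⟨ IH i J (l + k) 1 i≤39 by-≤? by-≤? (trans (cong (_+ 1) shift) eq) ⟩
        ones d + 3 * (l + k) + 1          ≡⟨ shuffle (ones d) l k ⟩
        3 * k + ones d + 3 * l + 1        ≤⟨ +-monoˡ-≤ 1 (+-monoˡ-≤ (3 * l) (+-monoˡ-≤ (ones d) (≤-trans (m≤n+m (3 * k) f) cost))) ⟩
        ones e + ones d + 3 * l + 1       ∎)
        where
        shuffle : ∀ d l k → d + 3 * (l + k) + 1 ≡ 3 * k + d + 3 * l + 1
        shuffle = solve-∀
        shift : 3 ^ (l + k) * value d ≡ 3 ^ l * (value e * value d)
        shift = trans (sym (3^-*-assoc l k (value d)))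
          (cong (λ x → 3 ^ l * (x * value d)) (sym (trans e≡ (trans (cong (3 ^ k *_) c≡1) (*-identityʳ (3 ^ k))))))
      oddᶜ : ¬ 2 ∣ c
      oddᶜ = leader-odd oddₑ L
      by-form : c ≢ 1 → ¬ OddForm (value d)
      by-form _ (inj₁ (q , c' , c'≤ , d≡)) = 3^t∙c+1≢ (l + (k + q)) i J (*-mono-≤ (odd-pos oddᶜ) c'≥1)
          (*-mono-≤ (odd-leader-≤ c∈ oddᶜ) c'≤) i≥19 i≤39 (trans (cong (_+ 1) shift) eq)
        where
        c'≥1 : 1 ≤ c'
        c'≥1 = odd-pos λ 2∣ → oddᵈ (subst (2 ∣_) (sym d≡) (∣n⇒∣m*n (3 ^ q) 2∣))
        shuffle : ∀ a b x c c' → a * (b * x * (c * c')) ≡ a * (b * c * (x * c'))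
        shuffle = solve-∀
        shift : 3 ^ (l + (k + q)) * (c * c') ≡ 3 ^ l * (value e * value d)
        shift = trans (sym (3^-*-assoc l (k + q) (c * c'))) (trans (cong (λ y → 3 ^ l * (y * (c * c'))) (^-distribˡ-+-* 3 k q))
          (trans (shuffle (3 ^ l) (3 ^ k) (3 ^ q) c c') (sym (cong₂ (λ y z → 3 ^ l * (y * z)) e≡ d≡))))
      by-form c≢1 (inj₂ (q , a , m , a<6 , d≡)) = 3^t∙c∙[3^k∙2^a+1]+1≢ (l + (k + q)) m a i J c∈ oddᶜ c≢1 a<6 i≥19 i≤39
          (trans (cong (_+ 1) shift) eq)
        where
        s : ℕ
        s = 3 ^ m * 2 ^ a + 1
        shuffle : ∀ a b x c s → a * (b * x) * c * s ≡ a * (b * c * (x * s))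
        shuffle = solve-∀
        shift : 3 ^ (l + (k + q)) * c * s ≡ 3 ^ l * (value e * value d)
        shift = trans (cong (λ y → y * c * s) (trans (^-distribˡ-+-* 3 l (k + q)) (cong (3 ^ l *_) (^-distribˡ-+-* 3 k q))))
          (trans (shuffle (3 ^ l) (3 ^ k) (3 ^ q) c s) (sym (cong₂ (λ y z → 3 ^ l * (y * z)) e≡ d≡)))
      by-defect : c ≢ 1 → ¬ (c ≡ 1 ⊎ CoRatio 125 243 f c)
      by-defect c≢1 (inj₁ c≡1) = c≢1 c≡1
      by-defect c≢1 (inj₂ c-defect) = by-form c≢1 (classify-odd d oddᵈ (weaken 283 50 by-≤?
        (ratio-quotient (ones e) (ones d) (value e) (value d) 125 243 (value-pos e) (leader-coratio c-defect L) r)))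
      split : Dec (c ≡ 1) → ⊥
      split (yes c≡1) = trivial c≡1
      split (no c≢1)  = by-defect c≢1 (odd-leader-defect c∈ oddᶜ)

  -- With the bound 1099/100 the larger summand would escape the classification, as 10.99 / 3 >
  -- 83/25. But 3 ^ `suc l` forces J = 0 and then i even, so 977/100 holds, and (9.77 / 3) · 1.003³
  -- < 83/25.
  shift≢1-add : ∀ e d i J l → i ≤ 39 → 19 ≤ i → value d ≤ value e → 3 ^ suc l * (value e + value d) + 1 ≡ 2 ^ i * 3 ^ J →
    ¬ ones e + ones d + 3 * suc l + 1 < 2 * i + 3 * J
  shift≢1-add e d i (suc J) l _ _ _ eq _ = by-∤? (3∣shift l (value e + value d) 1 i J eq)
  shift≢1-add e d i zero l i≤39 i≥19 d≤e eq short = by-size (value d) refl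
    where
    eq′ : 3 ^ suc l * (value e + value d) + 1 ≡ 2 ^ i
    eq′ = trans eq (*-identityʳ (2 ^ i))
    l<26 : suc l < 26
    l<26 = 3^-exponent (suc l) (value e + value d) 1 (value-pos (add e d)) i≤39 eq′
    3^∣ : 3 ^ suc l ∣ 2 ^ i ∸ 1
    3^∣ = ∣shift (3 ^ suc l) (value e + value d) 1 i eq′
    r : Defect≤ 977 100 (add e d)
    r = weaken 977 100 by-≤? (shifted-ratio (add e d) 38 0 (suc l) 1 524287
      (check-even (s≤s i≤39) i≥19 (∣-trans (m∣m*n (3 ^ l)) 3^∣)) eq short (minuend-≥ 19 524287 1 0 i≥19 eq by-≤?))
    n≥1004 : 1004 ≤ value e + value d
    n≥1004 = ≤-trans by-≤? (*-cancelˡ-≤ (3 ^ suc l) {{m^n≢0 3 (suc l)}} (≤-trans (≤-reflexive (*-comm (3 ^ suc l) 195600))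
      (+-cancelʳ-≤ 1 _ _ (≤-trans (<⇒≤ (check-size (s≤s i≤39) i≥19 l<26 3^∣)) (≤-reflexive (sym eq′))))))
    d<4 : value d < 4
    d<4 = value-< d 3 4 (≤-pred (smaller-summand-< e (ones d) (value d) 1 1 4 (*-monoʳ-≤ 1 d≤e) by-≰? r)) by-≤?
    1000d≤3e : 1000 * value d ≤ 3 * value e
    1000d≤3e = scale-≤ 1000 3 (+-cancelʳ-≤ 4 1000 (value e) (≤-trans n≥1004 (+-monoʳ-≤ (value e) (<⇒≤ d<4)))) (≤-pred d<4)
    d<3 : value d < 3
    d<3 = value-< d 2 3 (≤-pred (smaller-summand-< e (ones d) (value d) 1000 3 3 1000d≤3e by-≰? r)) by-≤?
    by-value : ∀ x v → value e ≡ x → value d ≡ v → 3 ^ suc l * (x + v) + 1 ≡ 2 ^ i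
    by-value x v e≡ d≡ = trans (cong (λ n → 3 ^ suc l * n + 1) (sym (cong₂ _+_ e≡ d≡))) eq′
    exponent : ∀ m x v → 1 ≤ x → 3 ^ suc l * (3 ^ m * x + v) + 1 ≡ 2 ^ i → m < 26
    exponent m x v x≥1 eq = 3^-exponent m (3 ^ suc l * x) (3 ^ suc l * v + 1) (*-mono-≤ (m^n>0 3 (suc l)) x≥1) i≤39
      (trans (shuffle (3 ^ suc l) (3 ^ m) x v) eq)
      where
      shuffle : ∀ y z x v → z * (y * x) + (y * v + 1) ≡ y * (z * x + v) + 1
      shuffle = solve-∀
    by-leader : value d ≡ 1 → ¬ (Listed (ones e) (value e) ⊎ Near3^ (ones e) (value e))
    by-leader d≡ (inj₁ (c , f , c∈ , leader m e≡ _)) =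
      lookup (proj₁ (proj₂ (check-sum (s≤s i≤39) i≥19 l<26 (s≤s z≤n) 3^∣ (exponent m c 1 c≥1 eq″)))) c∈ eq″
      where
      eq″ : 3 ^ suc l * (3 ^ m * c + 1) + 1 ≡ 2 ^ i
      eq″ = by-value (3 ^ m * c) 1 e≡ d≡
      c≥1 : 1 ≤ c
      c≥1 = n≢0⇒n>0 λ c≡0 → contradiction (subst (1 ≤_) (trans e≡ (trans (cong (3 ^ m *_) c≡0) (*-zeroʳ (3 ^ m)))) (value-pos e)) λ ()
    by-leader d≡ (inj₂ (p , _ , leader m e≡ _)) =
      proj₂ (proj₂ (check-sum (s≤s i≤39) i≥19 l<26 (s≤s z≤n) 3^∣ (exponent m (3 ^ p + 1) 1 (m≤n+m 1 (3 ^ p)) eq″)))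
        (3^-exponent p (3 ^ suc l * 3 ^ m) (3 ^ suc l * (3 ^ m + 1) + 1) (*-mono-≤ (m^n>0 3 (suc l)) (m^n>0 3 m)) i≤39
          (trans (shuffle (3 ^ suc l) (3 ^ m) (3 ^ p)) eq″)) eq″
      where
      shuffle : ∀ y z x → x * (y * z) + (y * (z + 1) + 1) ≡ y * (z * (x + 1) + 1) + 1
      shuffle = solve-∀
      eq″ : 3 ^ suc l * (3 ^ m * (3 ^ p + 1) + 1) + 1 ≡ 2 ^ i
      eq″ = by-value (3 ^ m * (3 ^ p + 1)) 1 e≡ d≡
    by-smooth : value d ≡ 2 → ¬ (∃ λ a → a < 2 × Leader (2 ^ a) (2 * a) (ones e) (value e))
    by-smooth d≡ (0 , _ , leader m e≡ _) =
      proj₁ (check-sum (s≤s i≤39) i≥19 l<26 (s≤s z≤n) 3^∣ (exponent m 1 2 by-≤? (by-value (3 ^ m * 1) 2 e≡ d≡)))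
        (by-value (3 ^ m) 2 (trans e≡ (*-identityʳ (3 ^ m))) d≡)
    by-smooth d≡ (1 , _ , leader m e≡ _) = by-∤? {2} {1} (∣m+n∣m⇒∣n
      (subst (2 ∣_) (trans (*-identityʳ (2 ^ i)) (sym (by-value (3 ^ m * 2) 2 e≡ d≡))) (2^∣smooth 1 0 (≤-trans by-≤? i≥19)))
      (∣n⇒∣m*n (3 ^ suc l) (∣m∣n⇒∣m+n (∣n⇒∣m*n (3 ^ m) ∣-refl) ∣-refl)))
    by-smooth _ (suc (suc _) , s≤s (s≤s ()) , _)
    by-size : ∀ v → value d ≡ v → ⊥
    by-size 0 d≡ = contradiction (subst (1 ≤_) d≡ (value-pos d)) λ ()
    by-size 1 d≡ = by-leader d≡ (classify e (weaken 83 25 by-≤?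
      (ratio-summand (ones e) (ones d) (value e) (value d) 1000 3 1 (ones-pos d) 1000d≤3e r)))
    by-size 2 d≡ = by-smooth d≡ (classify-smooth-<2 e (weaken 5 4 by-≤?
      (ratio-summand (ones e) (ones d) (value e) (value d) 1000 3 2
        (<-ones 1 2 by-≤? (subst (λ v → v ^ 3 ≤ 3 ^ ones d) d≡ (cube≤3^ones d))) 1000d≤3e r)))
    by-size (suc (suc (suc v))) d≡ = contradiction (subst (_< 3) d≡ d<3) λ { (s≤s (s≤s (s≤s ()))) }

-- The induction for the complexity of 2 ^ i 3 ^ J

opaque
  shift1-defect : ∀ e i J l → i ≤ 39 → 3 ^ l * value e + 1 ≡ 2 ^ i * 3 ^ J → ones e + 3 * l + 1 < 2 * i + 3 * J →
    Defect≤ 1099 100 e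
  shift1-defect e i J l i≤39 eq short = weaken 1099 100 by-≤? (shifted-ratio e 39 J l 1 524287 i≤39 eq short
    (minuend-≥ 19 524287 1 J (shift≢1-exponent e {i} J l (shifted-exponent e J l 1 eq short) eq short) eq by-≤?))

  shift2-defect : ∀ e i J l → i ≤ 39 → 3 ^ l * value e + 2 ≡ 2 ^ i * 3 ^ J → ones e + 3 * l + 2 < 2 * i + 3 * J →
    Defect≤ 369 100 e
  shift2-defect e i J l i≤39 eq short = weaken 369 100 by-≤? (shifted-ratio e 39 J l 2 1022 i≤39 eq short
    (minuend-≥ 10 1022 2 J (shifted-exponent e {i} J l 2 eq short) eq by-≤?))

  shifted-add-zero : ∀ e d i J w → i ≤ 39 → w ≤ 2 → Shifted e → Shifted d →
    3 ^ 0 * (value e + value d) + w ≡ 2 ^ i * 3 ^ J → 2 * i + 3 * J ≤ ones e + ones d + 3 * 0 + w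
  shifted-add-zero e d i J w i≤39 w≤2 IHₑ IHᵈ eq =
    subst (λ k → 2 * i + 3 * J ≤ k + w) (sym (+-identityʳ (ones e + ones d))) (by-order (≤-total (value d) (value e)))
    where
    eq′ : value e + value d + w ≡ 2 ^ i * 3 ^ J
    eq′ = trans (cong (_+ w) (sym (*-identityˡ (value e + value d)))) eq
    by-order : value d ≤ value e ⊎ value e ≤ value d → 2 * i + 3 * J ≤ ones e + ones d + w
    by-order (inj₁ d≤e) = absorb e d i J w i≤39 w≤2 d≤e IHₑ eq′
    by-order (inj₂ e≤d) = subst (λ k → 2 * i + 3 * J ≤ k + w) (+-comm (ones d) (ones e))
      (absorb d e i J w i≤39 w≤2 e≤d IHᵈ (trans (cong (_+ w) (+-comm (value d) (value e))) eq′))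

smooth-lower : ∀ e i J → i ≤ 39 → value e ≡ 2 ^ i * 3 ^ J → 2 * i + 3 * J ≤ ones e
shifted : ∀ e → Shifted e

smooth-lower one i J _ eq = ≮⇒≥ λ short → contradiction
  (≤-trans (2^≤smooth 10 J (deficit-exponent one {i} J eq short)) (≤-reflexive (sym eq))) by-≰?
smooth-lower (mul e d) i J i≤39 eq with smooth-factors i J (value e) (value d) eq
... | smoothFactors a c p q e≡ d≡ refl refl = begin
  2 * (a + p) + 3 * (c + q)              ≡⟨ shuffle a c p q ⟩
  (2 * a + 3 * c) + (2 * p + 3 * q)      ≤⟨ +-mono-≤ (smooth-lower e a c (≤-trans (m≤m+n a p) i≤39) e≡)
                                                     (smooth-lower d p q (≤-trans (m≤n+m p a) i≤39) d≡) ⟩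
  ones e + ones d                        ∎
  where
  shuffle : ∀ a c p q → 2 * (a + p) + 3 * (c + q) ≡ (2 * a + 3 * c) + (2 * p + 3 * q)
  shuffle = solve-∀
smooth-lower (add e d) i J i≤39 eq = subst (2 * i + 3 * J ≤_) (+-identityʳ (ones e + ones d)) (by-order (≤-total (value d) (value e)))
  where
  by-order : value d ≤ value e ⊎ value e ≤ value d → 2 * i + 3 * J ≤ ones e + ones d + 0
  by-order (inj₁ d≤e) = absorb e d i J 0 i≤39 z≤n d≤e (shifted e) (trans (+-identityʳ (value e + value d)) eq)
  by-order (inj₂ e≤d) = subst (λ k → 2 * i + 3 * J ≤ k + 0) (+-comm (ones d) (ones e))
    (absorb d e i J 0 i≤39 z≤n e≤d (shifted d) (trans (+-identityʳ (value d + value e)) (trans (+-comm (value d) (value e)) eq)))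

shifted e i J l 3 i≤39 _ _ eq = ≮⇒≥ (shift≢3 e i J l i≤39 eq)
shifted _ _ _ _ (suc (suc (suc (suc _)))) _ _ (s≤s (s≤s (s≤s ()))) _
shifted one i J l w i≤39 _ w≤3 eq = ≮⇒≥ λ short → 8∤3^+ l (s≤s w≤3)
  (subst (8 ∣_) (trans (sym eq) (cong (_+ w) (*-identityʳ (3 ^ l))))
    (2^∣smooth 3 J (≤-trans by-≤? (shifted-exponent one {i} J l w eq short))))
-- With l = 0 the smaller summand can join w. Under a factor 3 ^ `suc l` it would count that many
-- times, so those clauses rely on classification instead of the induction hypothesis.
shifted (add e d) i J zero 1 i≤39 _ _ eq = shifted-add-zero e d i J 1 i≤39 by-≤? (shifted e) (shifted d) eq
shifted (add e d) i J zero 2 i≤39 _ _ eq = shifted-add-zero e d i J 2 i≤39 by-≤? (shifted e) (shifted d) eq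
shifted (add e d) i J (suc l) 1 i≤39 _ _ eq = ≮⇒≥ λ short → by-order short (≤-total (value d) (value e))
  where
  by-order : ones e + ones d + 3 * suc l + 1 < 2 * i + 3 * J → ¬ (value d ≤ value e ⊎ value e ≤ value d)
  by-order short (inj₁ d≤e) = shift≢1-add e d i J l i≤39 i≥19 d≤e eq short
    where
    i≥19 : 19 ≤ i
    i≥19 = shift≢1-exponent (add e d) J (suc l) (shifted-exponent (add e d) J (suc l) 1 eq short) eq short
  by-order short (inj₂ e≤d) = shift≢1-add d e i J l i≤39 i≥19 e≤d
      (trans (cong (λ n → 3 ^ suc l * n + 1) (+-comm (value d) (value e))) eq)
      (subst (λ k → k + 3 * suc l + 1 < 2 * i + 3 * J) (+-comm (ones e) (ones d)) short)
    where
    i≥19 : 19 ≤ i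
    i≥19 = shift≢1-exponent (add e d) J (suc l) (shifted-exponent (add e d) J (suc l) 1 eq short) eq short
shifted (add e d) i J (suc l) 2 i≤39 _ _ eq = ≮⇒≥ λ short →
  add-wlog (λ k n → Ratio 369 100 k n → 3 ^ suc l * n + 2 ≢ 2 ^ i * 3 ^ J)
    (λ e d d≤e r → shift≢2-add e d i J l i≤39 (i≥10 short) d≤e r) e d (shift2-defect (add e d) i J (suc l) i≤39 eq short) eq
  where
  i≥10 : ones e + ones d + 3 * suc l + 2 < 2 * i + 3 * J → 10 ≤ i
  i≥10 = shifted-exponent (add e d) J (suc l) 2 eq
shifted (mul e d) i J l 1 i≤39 _ _ eq = ≮⇒≥ λ short → by-split short
    (ratio-split (ones e) (ones d) (value e) (value d) 25 83 (value-pos e) by-≤? (shift1-defect (mul e d) i J l i≤39 eq short))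
  where
  i≥19 : ones e + ones d + 3 * l + 1 < 2 * i + 3 * J → 19 ≤ i
  i≥19 short = shift≢1-exponent (mul e d) J l (shifted-exponent (mul e d) J l 1 eq short) eq short
  by-split : ones e + ones d + 3 * l + 1 < 2 * i + 3 * J → ¬ (Defect≤ 83 25 e ⊎ Defect≤ 83 25 d)
  by-split short (inj₁ rₑ) =
    shift≢1-mul e d i J l i≤39 (i≥19 short) rₑ (shifted d) (shift1-defect (mul e d) i J l i≤39 eq short) eq short
  by-split short (inj₂ rᵈ) =
    shift≢1-mul d e i J l i≤39 (i≥19 short) rᵈ (shifted e)
      (ratio-comm (ones e) (ones d) (value e) (value d) (shift1-defect (mul e d) i J l i≤39 eq short))
      (trans (cong (λ n → 3 ^ l * n + 1) (*-comm (value d) (value e))) eq)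
      (subst (λ k → k + 3 * l + 1 < 2 * i + 3 * J) (+-comm (ones e) (ones d)) short)
shifted (mul e d) i J l 2 i≤39 _ _ eq = ≮⇒≥ λ short → by-split short
    (ratio-split (ones e) (ones d) (value e) (value d) 50 97 (value-pos e) by-≤? (shift2-defect (mul e d) i J l i≤39 eq short))
  where
  i≥10 : ones e + ones d + 3 * l + 2 < 2 * i + 3 * J → 10 ≤ i
  i≥10 = shifted-exponent (mul e d) J l 2 eq
  by-split : ones e + ones d + 3 * l + 2 < 2 * i + 3 * J → ¬ (Defect≤ 97 50 e ⊎ Defect≤ 97 50 d)
  by-split short (inj₁ rₑ) =
    shift≢2-mul e d i J l i≤39 (i≥10 short) (classify-smooth e rₑ) (shifted d) (shift2-defect (mul e d) i J l i≤39 eq short) eq short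
  by-split short (inj₂ rᵈ) =
    shift≢2-mul d e i J l i≤39 (i≥10 short) (classify-smooth d rᵈ) (shifted e)
      (ratio-comm (ones e) (ones d) (value e) (value d) (shift2-defect (mul e d) i J l i≤39 eq short))
      (trans (cong (λ n → 3 ^ l * n + 2) (*-comm (value d) (value e))) eq)
      (subst (λ k → k + 3 * l + 2 < 2 * i + 3 * J) (+-comm (ones e) (ones d)) short)

-- Leading parts of expressions

-- Nothing is pruned below a kept addition: its summands are within a factor M of each other, so a
-- bound on the defect bounds its whole value.
data Pruned (M : ℕ) : Expr → Expr → ℕ → Set where
  one   : Pruned M one one 0
  mul   : ∀ {e d p q c c'} → Pruned M e p c → Pruned M d q c' → Pruned M (mul e d) (mul p q) (c + c')
  dropʳ : ∀ {e d p c} → M * value d ≤ value e → Pruned M e p c → Pruned M (add e d) p (suc c)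
  dropˡ : ∀ {e d p c} → M * value e ≤ value d → Pruned M d p c → Pruned M (add e d) p (suc c)
  keep  : ∀ {e d} → value e < M * value d → value d < M * value e → Pruned M (add e d) (add e d) 0

prune : ∀ M e → ∃ λ p → ∃ λ c → Pruned M e p c
prune M one = one , 0 , one
prune M (mul e d) with prune M e | prune M d
... | p , c , P | q , c' , P' = mul p q , c + c' , mul P P'
prune M (add e d) with M * value d ≤? value e | M * value e ≤? value d
... | yes le | _ = let p , c , P = prune M e in p , suc c , dropʳ le P
... | no _   | yes le = let p , c , P = prune M d in p , suc c , dropˡ le P
... | no ≰e  | no ≰d = add e d , 0 , keep (≰⇒> ≰e) (≰⇒> ≰d)

opaque
  +-split-≡ : ∀ {a b a' b'} → a' ≤ a → b' ≤ b → a + b ≡ a' + b' → a ≡ a' × b ≡ b'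
  +-split-≡ {a} {b} {a'} {b'} a'≤a b'≤b eq =
    ≤-antisym (+-cancelʳ-≤ b a a' (≤-trans (≤-reflexive eq) (+-monoʳ-≤ a' b'≤b))) a'≤a ,
    ≤-antisym (+-cancelˡ-≤ a b b' (≤-trans (≤-reflexive eq) (+-monoˡ-≤ b' a'≤a))) b'≤b

  not-both : ∀ {M M' u v} → 2 ≤ M → M ≤ M' → 1 ≤ u → M * u ≤ v → ¬ M' * v ≤ u
  not-both {M} {M'} {u} {v} 2≤M M≤M' u≥1 le le' = <⇒≱ (begin-strict
    u              <⟨ m<m+n u u≥1 ⟩
    u + u          ≡⟨ cong (u +_) (+-identityʳ u) ⟨
    2 * u          ≤⟨ *-monoˡ-≤ u 2≤M ⟩
    M * u          ≤⟨ le ⟩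
    v              ≡⟨ *-identityˡ v ⟨
    1 * v          ≤⟨ *-monoˡ-≤ v (≤-trans (≤-trans (n≤1+n 1) 2≤M) M≤M') ⟩
    M' * v         ∎) le'

  -- Where the two prunings part, the larger scale keeps the addition and counts 0 against at least
  -- 1, so equal counts exclude any difference. They never drop opposite summands, by `not-both`.
  pruned-mono : ∀ {M M' e p p' c c'} → 2 ≤ M → M ≤ M' → Pruned M e p c → Pruned M' e p' c' → c' ≤ c × (c ≡ c' → p ≡ p')
  pruned-mono 2≤M M≤M' one one = z≤n , λ _ → refl
  pruned-mono 2≤M M≤M' (mul P Q) (mul P' Q') with pruned-mono 2≤M M≤M' P P' | pruned-mono 2≤M M≤M' Q Q'
  ... | c'≤c , same | d'≤d , same′ = +-mono-≤ c'≤c d'≤d , λ eq →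
    let c≡ , d≡ = +-split-≡ c'≤c d'≤d eq in cong₂ mul (same c≡) (same′ d≡)
  pruned-mono 2≤M M≤M' (dropʳ _ P) (dropʳ _ P') with pruned-mono 2≤M M≤M' P P'
  ... | c'≤c , same = s≤s c'≤c , λ eq → same (suc-injective eq)
  pruned-mono 2≤M M≤M' (dropˡ _ P) (dropˡ _ P') with pruned-mono 2≤M M≤M' P P'
  ... | c'≤c , same = s≤s c'≤c , λ eq → same (suc-injective eq)
  pruned-mono 2≤M M≤M' (dropʳ {d = d} le _) (dropˡ le' _) = contradiction le' (not-both 2≤M M≤M' (value-pos d) le)
  pruned-mono 2≤M M≤M' (dropˡ {e = e} le _) (dropʳ le' _) = contradiction le' (not-both 2≤M M≤M' (value-pos e) le)
  pruned-mono 2≤M M≤M' (dropʳ _ _) (keep _ _) = z≤n , λ ()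
  pruned-mono 2≤M M≤M' (dropˡ _ _) (keep _ _) = z≤n , λ ()
  pruned-mono 2≤M M≤M' (keep {d = d} lt _) (dropʳ le _) = contradiction (≤-trans (*-monoˡ-≤ (value d) M≤M') le) (<⇒≱ lt)
  pruned-mono 2≤M M≤M' (keep {e = e} _ lt) (dropˡ le _) = contradiction (≤-trans (*-monoˡ-≤ (value e) M≤M') le) (<⇒≱ lt)
  pruned-mono 2≤M M≤M' (keep _ _) (keep _ _) = z≤n , λ _ → refl

  pruned-ones : ∀ {M e p c} → Pruned M e p c → ones p + c ≤ ones e
  pruned-ones one = ≤-refl
  pruned-ones (mul {p = p} {q} {c} {c'} P Q) =
    ≤-trans (≤-reflexive (shuffle (ones p) (ones q) c c')) (+-mono-≤ (pruned-ones P) (pruned-ones Q))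
    where
    shuffle : ∀ a b c d → a + b + (c + d) ≡ a + c + (b + d)
    shuffle = solve-∀
  pruned-ones (dropʳ {e} {d} {p} {c} _ P) =
    ≤-trans (≤-reflexive (trans (+-suc (ones p) c) (+-comm 1 _))) (+-mono-≤ (pruned-ones P) (ones-pos d))
  pruned-ones (dropˡ {e} {d} {p} {c} _ P) =
    ≤-trans (≤-reflexive (+-suc (ones p) c)) (+-mono-≤ (ones-pos e) (pruned-ones P))
  pruned-ones (keep {e} {d} _ _) = ≤-reflexive (+-identityʳ (ones e + ones d))

  pruned-≤ : ∀ {M e p c} → Pruned M e p c → value p ≤ value e
  pruned-≤ one         = ≤-refl
  pruned-≤ (mul P Q)   = *-mono-≤ (pruned-≤ P) (pruned-≤ Q)
  pruned-≤ (dropʳ _ P) = ≤-trans (pruned-≤ P) (m≤m+n _ _)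
  pruned-≤ (dropˡ _ P) = ≤-trans (pruned-≤ P) (m≤n+m _ _)
  pruned-≤ (keep _ _)  = ≤-refl

  drop-step : ∀ M u v x c → M * v ≤ u → u * M ^ c ≤ x * suc M ^ c → (u + v) * M ^ suc c ≤ x * suc M ^ suc c
  drop-step M u v x c le IH = begin
    (u + v) * (M * M ^ c)          ≡⟨ shuffle u v M (M ^ c) ⟩
    (u * M + M * v) * M ^ c        ≤⟨ *-monoˡ-≤ (M ^ c) (+-monoʳ-≤ (u * M) le) ⟩
    (u * M + u) * M ^ c            ≡⟨ shuffle′ u M (M ^ c) ⟩
    (1 + M) * (u * M ^ c)          ≤⟨ *-monoʳ-≤ (1 + M) IH ⟩
    (1 + M) * (x * suc M ^ c)      ≡⟨ shuffle″ (1 + M) x (suc M ^ c) ⟩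
    x * (suc M * suc M ^ c)        ∎
    where
    shuffle : ∀ u v m t → (u + v) * (m * t) ≡ (u * m + m * v) * t
    shuffle = solve-∀
    shuffle′ : ∀ u m t → (u * m + u) * t ≡ (1 + m) * (u * t)
    shuffle′ = solve-∀
    shuffle″ : ∀ m x t → m * (x * t) ≡ x * (m * t)
    shuffle″ = solve-∀

  pruned-≥ : ∀ {M e p c} → Pruned M e p c → value e * M ^ c ≤ value p * suc M ^ c
  pruned-≥ one = ≤-refl
  pruned-≥ {M} (mul {e} {d} {p} {q} {c} {c'} P Q) = begin
    value e * value d * M ^ (c + c')               ≡⟨ cong (value e * value d *_) (^-distribˡ-+-* M c c') ⟩
    value e * value d * (M ^ c * M ^ c')           ≡⟨ shuffle (value e) (value d) (M ^ c) (M ^ c') ⟩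
    value e * M ^ c * (value d * M ^ c')           ≤⟨ *-mono-≤ (pruned-≥ P) (pruned-≥ Q) ⟩
    value p * suc M ^ c * (value q * suc M ^ c')   ≡⟨ shuffle (value p) (value q) (suc M ^ c) (suc M ^ c') ⟨
    value p * value q * (suc M ^ c * suc M ^ c')   ≡⟨ cong (value p * value q *_) (^-distribˡ-+-* (suc M) c c') ⟨
    value p * value q * suc M ^ (c + c')           ∎
    where
    shuffle : ∀ a b c d → a * b * (c * d) ≡ a * c * (b * d)
    shuffle = solve-∀
  pruned-≥ {M} (dropʳ {e} {d} {p} {c} le P) = drop-step M (value e) (value d) (value p) c le (pruned-≥ P)
  pruned-≥ {M} (dropˡ {e} {d} {p} {c} le P) = subst (λ n → n * M ^ suc c ≤ value p * suc M ^ suc c)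
    (+-comm (value d) (value e)) (drop-step M (value d) (value e) (value p) c le (pruned-≥ P))
  pruned-≥ (keep _ _) = ≤-refl

  pigeonhole : ∀ G (f : ℕ → ℕ) → (∀ k → f (suc k) ≤ f k) → f 0 ≤ G → ∃ λ k → k ≤ G × f k ≡ f (suc k)
  pigeonhole G f anti f0≤G with f 0 ≟ f 1
  ... | yes eq = 0 , z≤n , eq
  pigeonhole zero f anti f0≤G | no ≢ = contradiction (trans (n≤0⇒n≡0 f0≤G) (sym (n≤0⇒n≡0 (≤-trans (anti 0) f0≤G)))) ≢
  pigeonhole (suc G) f anti f0≤G | no ≢ with pigeonhole G (λ k → f (suc k)) (λ k → anti (suc k))
                                               (≤-pred (≤-trans (≤∧≢⇒< (anti 0) (λ eq → ≢ (sym eq))) f0≤G))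
  ... | k , k≤G , eq = suc k , s≤s k≤G , eq

  n<2^n : ∀ n → n < 2 ^ n
  n<2^n zero    = s≤s z≤n
  n<2^n (suc n) = begin
    suc (suc n)        ≤⟨ s≤s (n<2^n n) ⟩
    1 + 2 ^ n          ≤⟨ +-monoˡ-≤ (2 ^ n) (m^n>0 2 n) ⟩
    2 ^ n + 2 ^ n      ≡⟨ cong (2 ^ n +_) (+-identityʳ (2 ^ n)) ⟨
    2 * 2 ^ n          ∎

  *-^ : ∀ a b n → (a * b) ^ n ≡ a ^ n * b ^ n
  *-^ a b zero    = refl
  *-^ a b (suc n) = trans (cong (a * b *_) (*-^ a b n)) (shuffle a b (a ^ n) (b ^ n))
    where
    shuffle : ∀ a b c d → a * b * (c * d) ≡ a * c * (b * d)
    shuffle = solve-∀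

  -- A summand dropped at ratio 8 triples 3 ^ ones but multiplies the cube of the value by at most (9/8)³ < 3/2.
  drops-≤ : ∀ {G e p c} → Pruned 8 e p c → Defect≤ G 1 e → c ≤ G
  drops-≤ {G} {e} {p} {c} P (ratio r) = <⇒≤ (<-≤-trans (n<2^n c)
    (*-cancelʳ-≤ (2 ^ c) G (729 ^ c * x) {{m*n≢0 (729 ^ c) x {{m^n≢0 729 c}} {{cube-nonZero (value-pos p)}}}} (begin
      2 ^ c * (729 ^ c * x)            ≡⟨ *-assoc (2 ^ c) (729 ^ c) x ⟨
      2 ^ c * 729 ^ c * x              ≡⟨ cong (_* x) (*-^ 2 729 c) ⟨
      1458 ^ c * x                     ≤⟨ *-monoˡ-≤ x (^-monoˡ-≤ c (by-≤? {1458} {1536})) ⟩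
      1536 ^ c * x                     ≡⟨ cong (_* x) (*-^ 3 512 c) ⟩
      3 ^ c * 512 ^ c * x              ≤⟨ *-monoʳ-≤ (3 ^ c * 512 ^ c) (cube≤3^ones p) ⟩
      3 ^ c * 512 ^ c * 3 ^ ones p     ≡⟨ shuffle (3 ^ c) (512 ^ c) (3 ^ ones p) ⟩
      512 ^ c * (3 ^ ones p * 3 ^ c)   ≡⟨ cong (512 ^ c *_) (^-distribˡ-+-* 3 (ones p) c) ⟨
      512 ^ c * 3 ^ (ones p + c)       ≤⟨ *-monoʳ-≤ (512 ^ c) (^-monoʳ-≤ 3 (pruned-ones P)) ⟩
      512 ^ c * 3 ^ ones e             ≤⟨ *-monoʳ-≤ (512 ^ c) (≤-trans (≤-reflexive (sym (*-identityˡ _))) r) ⟩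
      512 ^ c * (G * value e ^ 3)      ≡⟨ shuffle′ (512 ^ c) G (value e ^ 3) ⟩
      G * (value e ^ 3 * 512 ^ c)      ≤⟨ *-monoʳ-≤ G cubes ⟩
      G * (x * 729 ^ c)                ≡⟨ cong (G *_) (*-comm x (729 ^ c)) ⟩
      G * (729 ^ c * x)                ∎)))
    where
    x : ℕ
    x = value p ^ 3
    shuffle : ∀ a b c → a * b * c ≡ b * (c * a)
    shuffle = solve-∀
    shuffle′ : ∀ a b c → a * (b * c) ≡ b * (c * a)
    shuffle′ = solve-∀
    swap-^ : ∀ a n → (a ^ 3) ^ n ≡ (a ^ n) ^ 3
    swap-^ a n = trans (^-*-assoc a 3 n) (trans (cong (a ^_) (*-comm 3 n)) (sym (^-*-assoc a n 3)))
    cubes : value e ^ 3 * 512 ^ c ≤ x * 729 ^ c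
    cubes = begin
      value e ^ 3 * 512 ^ c       ≡⟨ cong (value e ^ 3 *_) (swap-^ 8 c) ⟩
      value e ^ 3 * (8 ^ c) ^ 3   ≡⟨ cube-* (value e) (8 ^ c) ⟨
      (value e * 8 ^ c) ^ 3       ≤⟨ ^-monoˡ-≤ 3 (pruned-≥ P) ⟩
      (value p * 9 ^ c) ^ 3       ≡⟨ cube-* (value p) (9 ^ c) ⟩
      x * (9 ^ c) ^ 3             ≡⟨ cong (x *_) (swap-^ 9 c) ⟨
      x * 729 ^ c                 ∎

-- Each of the blocks is at most W and not a power of 3, hence has ratio at least 1 + 1 / W ^ 3.
record Decomposed (W k n : ℕ) : Set where
  constructor decomposed
  field
    power rest blocks : ℕ
    n≡     : n ≡ 3 ^ power * rest
    rest≤  : rest ≤ W ^ blocks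
    defect : n ^ 3 * suc (W ^ 3) ^ blocks ≤ 3 ^ k * (W ^ 3) ^ blocks

-- 8 G bounds the smaller summand of a kept addition, and the larger one is less than M times that.
blockBound : ℕ → ℕ → ℕ
blockBound G M = suc M * (8 * G)

-- With W the bound for one block, W ^ 3 * G bounds the number of blocks.
restBound : ℕ → ℕ → ℕ
restBound G M = blockBound G M ^ (blockBound G M ^ 3 * G)

opaque
  decomposed-* : ∀ {W k m x y} → Decomposed W k x → Decomposed W m y → Decomposed W (k + m) (x * y)
  decomposed-* {W} {k} {m} (decomposed w a t refl a≤ def) (decomposed w' a' t' refl a'≤ def') =
    decomposed (w + w') (a * a') (t + t')
      (trans (shuffle (3 ^ w) a (3 ^ w') a') (cong (_* (a * a')) (sym (^-distribˡ-+-* 3 w w'))))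
      (≤-trans (*-mono-≤ a≤ a'≤) (≤-reflexive (sym (^-distribˡ-+-* W t t'))))
      (begin
        (x * y) ^ 3 * S ^ (t + t')                   ≡⟨ cong₂ _*_ (cube-* x y) (^-distribˡ-+-* S t t') ⟩
        x ^ 3 * y ^ 3 * (S ^ t * S ^ t')             ≡⟨ shuffle (x ^ 3) (y ^ 3) (S ^ t) (S ^ t') ⟩
        x ^ 3 * S ^ t * (y ^ 3 * S ^ t')             ≤⟨ *-mono-≤ def def' ⟩
        3 ^ k * R ^ t * (3 ^ m * R ^ t')             ≡⟨ shuffle (3 ^ k) (R ^ t) (3 ^ m) (R ^ t') ⟩
        3 ^ k * 3 ^ m * (R ^ t * R ^ t')             ≡⟨ cong₂ _*_ (^-distribˡ-+-* 3 k m) (^-distribˡ-+-* R t t') ⟨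
        3 ^ (k + m) * R ^ (t + t')                   ∎)
    where
    x y R S : ℕ
    x = 3 ^ w * a
    y = 3 ^ w' * a'
    R = W ^ 3
    S = suc (W ^ 3)
    shuffle : ∀ a b c d → a * b * (c * d) ≡ a * c * (b * d)
    shuffle = solve-∀

  cube≡3^⇒power : ∀ n k → n ^ 3 ≡ 3 ^ k → ∃ λ w → n ≡ 3 ^ w
  cube≡3^⇒power n k eq with smooth-factors 0 k n (n * (n * 1)) (trans eq (sym (*-identityˡ (3 ^ k))))
  ... | smoothFactors a c p q n≡ _ a+p _ with m+n≡0⇒m≡0 a a+p
  ... | refl = c , trans n≡ (*-identityˡ (3 ^ c))

  decomposed-block : ∀ {W} e → value e ≤ W → Decomposed W (ones e) (value e)
  decomposed-block {W} e e≤W with value e ^ 3 ≟ 3 ^ ones e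
  ... | yes eq = let w , e≡ = cube≡3^⇒power (value e) (ones e) eq in
    decomposed w 1 0 (trans e≡ (sym (*-identityʳ (3 ^ w)))) ≤-refl (*-monoˡ-≤ 1 (cube≤3^ones e))
  ... | no ≢ = decomposed 0 (value e) 1 (sym (*-identityˡ (value e))) (≤-trans e≤W (≤-reflexive (sym (*-identityʳ W)))) (begin
    x * (suc R * 1)        ≡⟨ shuffle x R ⟩
    x * R + x              ≤⟨ +-monoʳ-≤ (x * R) (^-monoˡ-≤ 3 e≤W) ⟩
    x * R + R              ≡⟨ shuffle′ x R ⟩
    suc x * (R * 1)        ≤⟨ *-monoˡ-≤ (R * 1) (≤∧≢⇒< (cube≤3^ones e) ≢) ⟩
    3 ^ ones e * (R * 1)   ∎)
    where
    x R : ℕ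
    x = value e ^ 3
    R = W ^ 3
    shuffle : ∀ x r → x * ((1 + r) * 1) ≡ x * r + x
    shuffle = solve-∀
    shuffle′ : ∀ x r → x * r + r ≡ (1 + x) * (r * 1)
    shuffle′ = solve-∀

  -- Removing d at most halves the value, so 3 ^ `ones d` cannot exceed 2³ G.
  smaller-summand-≤ : ∀ {G} e d → value d ≤ value e → Ratio G 1 (ones e + ones d) (value e + value d) → value d ≤ 8 * G
  smaller-summand-≤ {G} e d d≤e r = begin
    value d                   ≤⟨ m≤m*n (value d) (value d * (value d * 1))
                                   {{m*n≢0 (value d) (value d * 1) {{nz}} {{m*n≢0 (value d) 1 {{nz}}}}}} ⟩
    value d ^ 3               ≤⟨ cube≤3^ones d ⟩
    3 ^ ones d                ≡⟨ *-identityˡ (3 ^ ones d) ⟨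
    1 * 3 ^ ones d            ≤⟨ ratio-lower (value-pos e) (cube≤3^ones e)
                                   (ratio-summand (ones e) (ones d) (value e) (value d) 1 1 (ones d) ≤-refl (*-monoʳ-≤ 1 d≤e) r) ⟩
    G * 8                     ≡⟨ *-comm G 8 ⟩
    8 * G                     ∎
    where
    nz : NonZero (value d)
    nz = >-nonZero (value-pos d)

  kept-≤ : ∀ {G M} e d → value e < M * value d → value d < M * value e → Defect≤ G 1 (add e d) →
    value e + value d ≤ blockBound G M
  kept-≤ {G} {M} e d e< d< r with ≤-total (value d) (value e)
  ... | inj₁ d≤e = begin
    value e + value d      ≡⟨ +-comm (value e) (value d) ⟩
    value d + value e      ≤⟨ +-monoʳ-≤ (value d) (<⇒≤ e<) ⟩
    suc M * value d        ≤⟨ *-monoʳ-≤ (suc M) (smaller-summand-≤ e d d≤e r) ⟩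
    suc M * (8 * G)        ∎
  ... | inj₂ e≤d = begin
    value e + value d      ≤⟨ +-monoʳ-≤ (value e) (<⇒≤ d<) ⟩
    suc M * value e        ≤⟨ *-monoʳ-≤ (suc M) (smaller-summand-≤ d e e≤d
                                (subst₂ (Ratio G 1) (+-comm (ones e) (ones d)) (+-comm (value e) (value d)) r)) ⟩
    suc M * (8 * G)        ∎

  pruned-decomposed : ∀ {G M e p c} → Pruned M e p c → Defect≤ G 1 p → Decomposed (blockBound G M) (ones p) (value p)
  pruned-decomposed one _ = decomposed 0 1 0 refl ≤-refl (s≤s z≤n)
  pruned-decomposed (mul {p = p} {q} P Q) r =
    decomposed-* (pruned-decomposed P (defect-factorˡ p q r)) (pruned-decomposed Q (defect-factorʳ p q r))
  pruned-decomposed (dropʳ _ P) r = pruned-decomposed P r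
  pruned-decomposed (dropˡ _ P) r = pruned-decomposed P r
  pruned-decomposed {M = M} (keep {e} {d} e< d<) r = decomposed-block (add e d) (kept-≤ {M = M} e d e< d< r)

  bernoulli : ∀ X t → (X + t) * X ^ t ≤ X * suc X ^ t
  bernoulli X zero    = ≤-reflexive (cong (_* 1) (+-identityʳ X))
  bernoulli X (suc t) = begin
    (X + suc t) * (X * X ^ t)             ≤⟨ m≤m+n _ (t * X ^ t) ⟩
    (X + suc t) * (X * X ^ t) + t * X ^ t ≡⟨ shuffle X t (X ^ t) ⟩
    (1 + X) * ((X + t) * X ^ t)           ≤⟨ *-monoʳ-≤ (1 + X) (bernoulli X t) ⟩
    (1 + X) * (X * suc X ^ t)             ≡⟨ shuffle′ (1 + X) X (suc X ^ t) ⟩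
    X * suc X ^ suc t                     ∎
    where
    shuffle : ∀ x t y → (x + (1 + t)) * (x * y) + t * y ≡ (1 + x) * ((x + t) * y)
    shuffle = solve-∀
    shuffle′ : ∀ a b c → a * (b * c) ≡ b * (a * c)
    shuffle′ = solve-∀

  -- With X = W ^ 3 and t blocks, (1 + 1 / X) ^ t ≤ G; Bernoulli's inequality turns this into 1 + t
  -- / X ≤ G.
  rest-bound : ∀ {G W k n} → 1 ≤ W → 1 ≤ n → Ratio G 1 k n → (d : Decomposed W k n) → Decomposed.rest d ≤ W ^ (W ^ 3 * G)
  rest-bound {G} {W} {k} {n} W≥1 n≥1 (ratio r) (decomposed w a t _ a≤ def) =
    ≤-trans a≤ (^-monoʳ-≤ W {{>-nonZero W≥1}} t≤)
    where
    X : ℕ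
    X = W ^ 3
    instance
      X≢0 : NonZero X
      X≢0 = cube-nonZero W≥1
      n³≢0 : NonZero (n ^ 3)
      n³≢0 = cube-nonZero n≥1
    growth : suc X ^ t ≤ G * X ^ t
    growth = *-cancelˡ-≤ (n ^ 3) (begin
      n ^ 3 * suc X ^ t      ≤⟨ def ⟩
      3 ^ k * X ^ t          ≤⟨ *-monoˡ-≤ (X ^ t) (≤-trans (≤-reflexive (sym (*-identityˡ (3 ^ k)))) r) ⟩
      G * n ^ 3 * X ^ t      ≡⟨ shuffle G (n ^ 3) (X ^ t) ⟩
      n ^ 3 * (G * X ^ t)    ∎)
      where
      shuffle : ∀ a b c → a * b * c ≡ b * (a * c)
      shuffle = solve-∀
    t≤ : t ≤ X * G
    t≤ = ≤-trans (m≤n+m t X) (*-cancelʳ-≤ (X + t) (X * G) (X ^ t) {{m^n≢0 X t}} (begin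
      (X + t) * X ^ t        ≤⟨ bernoulli X t ⟩
      X * suc X ^ t          ≤⟨ *-monoʳ-≤ X growth ⟩
      X * (G * X ^ t)        ≡⟨ *-assoc X G (X ^ t) ⟨
      X * G * X ^ t          ∎))

-- Approximation by the pruned value

opaque
  -- Bernoulli's inequality (1 - 1 / (M + 1)) ^ c ≥ 1 - c / (M + 1) with denominators cleared. It
  -- makes the relative error of a pruning linear in the number of drops.
  close-power : ∀ M c → suc M ^ c * suc M ≤ M ^ c * suc M + suc M ^ c * c
  close-power M zero    = m≤m+n (1 * suc M) 0
  close-power M (suc c) = begin
    m * m ^ c * m                                ≡⟨ *-assoc m (m ^ c) m ⟩
    m * (m ^ c * m)                              ≤⟨ *-monoʳ-≤ m (close-power M c) ⟩
    m * (M ^ c * m + m ^ c * c)                  ≡⟨ shuffle M (M ^ c) (m ^ c) c ⟩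
    M * M ^ c * m + (M ^ c * m + m * m ^ c * c)  ≤⟨ +-monoʳ-≤ (M * M ^ c * m) (+-monoˡ-≤ (m * m ^ c * c)
                                                      (*-monoˡ-≤ m (^-monoˡ-≤ c (n≤1+n M)))) ⟩
    M * M ^ c * m + (m ^ c * m + m * m ^ c * c)  ≡⟨ cong (M * M ^ c * m +_) (shuffle′ m (m ^ c) c) ⟩
    M * M ^ c * m + m * m ^ c * suc c            ∎
    where
    m : ℕ
    m = suc M
    shuffle : ∀ M x y c → (1 + M) * (x * (1 + M) + y * c) ≡ M * x * (1 + M) + (x * (1 + M) + (1 + M) * y * c)
    shuffle = solve-∀
    shuffle′ : ∀ m y c → y * m + m * y * c ≡ m * y * (1 + c)
    shuffle′ = solve-∀

  pruned-close : ∀ {M e p c} → Pruned M e p c → value e * suc M ≤ value p * suc M + value e * c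
  pruned-close {M} {e} {p} {c} P = *-cancelˡ-≤ (m ^ c) {{m^n≢0 m c}} (begin
    m ^ c * (value e * m)                                ≡⟨ shuffle (m ^ c) (value e) m ⟩
    value e * (m ^ c * m)                                ≤⟨ *-monoʳ-≤ (value e) (close-power M c) ⟩
    value e * (M ^ c * m + m ^ c * c)                    ≡⟨ shuffle′ (value e) (M ^ c) m (m ^ c) c ⟩
    value e * M ^ c * m + m ^ c * (value e * c)          ≤⟨ +-monoˡ-≤ (m ^ c * (value e * c)) (*-monoˡ-≤ m (pruned-≥ P)) ⟩
    value p * m ^ c * m + m ^ c * (value e * c)          ≡⟨ shuffle″ (value p) (m ^ c) m (value e * c) ⟩
    m ^ c * (value p * m + value e * c)                  ∎)
    where
    m : ℕ
    m = suc M
    shuffle : ∀ x e m → x * (e * m) ≡ e * (x * m)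
    shuffle = solve-∀
    shuffle′ : ∀ e y m x c → e * (y * m + x * c) ≡ e * y * m + x * (e * c)
    shuffle′ = solve-∀
    shuffle″ : ∀ p x m z → p * x * m + x * z ≡ x * (p * m + z)
    shuffle″ = solve-∀

  at-most-double : ∀ {N L m G} → 1 ≤ m → 2 * G ≤ m → N * m ≤ L * m + N * G → N ≤ 2 * L
  at-most-double {N} {L} {m} {G} m≥1 2G≤m close = *-cancelʳ-≤ N (2 * L) m {{>-nonZero m≥1}}
    (+-cancelʳ-≤ (N * m) (N * m) (2 * L * m) (begin
    N * m + N * m               ≡⟨ shuffle (N * m) ⟩
    2 * (N * m)                 ≤⟨ *-monoʳ-≤ 2 close ⟩
    2 * (L * m + N * G)         ≡⟨ shuffle′ L m N G ⟩
    2 * L * m + N * (2 * G)     ≤⟨ +-monoʳ-≤ (2 * L * m) (*-monoʳ-≤ N 2G≤m) ⟩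
    2 * L * m + N * m           ∎))
    where
    shuffle : ∀ x → x + x ≡ 2 * x
    shuffle = solve-∀
    shuffle′ : ∀ l m n g → 2 * (l * m + n * g) ≡ 2 * l * m + n * (2 * g)
    shuffle′ = solve-∀

  ∣-gap : ∀ {d x y} → d ∣ x → d ∣ y → x < y → x + d ≤ y
  ∣-gap {d} (divides a refl) (divides b refl) lt =
    ≤-trans (≤-reflexive (+-comm (a * d) d)) (*-monoˡ-≤ d (*-cancelʳ-< d a b lt))

  3^-∣ : ∀ {m n} x → m ≤ n → 3 ^ m ∣ x * 3 ^ n
  3^-∣ {m} x m≤n with m≤n⇒∃[o]m+o≡n m≤n
  ... | o , refl = ∣n⇒∣m*n x (subst (3 ^ m ∣_) (sym (^-distribˡ-+-* 3 m o)) (m∣m*n (3 ^ o)))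

  -- The witness is 3 to the minimum of w and J. If w is smaller, L = 3 ^ w A with A ≤ Z, so L ≥ 3 ^
  -- J / 2 keeps 3 ^ w comparable to 3 ^ J.
  common-power : ∀ i J {L Z} w A → 1 ≤ Z → A ≤ Z → L ≡ 3 ^ w * A → 3 ^ J ≤ 2 * L →
    ∃ λ d → d ∣ L × d ∣ 2 ^ i * 3 ^ J × 3 ^ J ≤ 2 * Z * d
  common-power i J {L} {Z} w A Z≥1 A≤Z L≡ 3^J≤ with ≤-total w J
  ... | inj₁ w≤J = 3 ^ w , divides A (trans L≡ (*-comm (3 ^ w) A)) , 3^-∣ (2 ^ i) w≤J , (begin
    3 ^ J               ≤⟨ 3^J≤ ⟩
    2 * L               ≡⟨ cong (2 *_) L≡ ⟩
    2 * (3 ^ w * A)     ≤⟨ *-monoʳ-≤ 2 (*-monoʳ-≤ (3 ^ w) A≤Z) ⟩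
    2 * (3 ^ w * Z)     ≡⟨ shuffle (3 ^ w) Z ⟩
    2 * Z * 3 ^ w       ∎)
    where
    shuffle : ∀ x z → 2 * (x * z) ≡ 2 * z * x
    shuffle = solve-∀
  ... | inj₂ J≤w = 3 ^ J , subst (3 ^ J ∣_) (trans (*-comm A (3 ^ w)) (sym L≡)) (3^-∣ A J≤w) , 3^-∣ {J} (2 ^ i) ≤-refl ,
    m≤n*m (3 ^ J) (2 * Z) {{m*n≢0 2 Z {{_}} {{>-nonZero Z≥1}}}}

  -- The values of p and 2 ^ i * 3 ^ J share a power of 3 that exceeds their distance.
  exact-value : ∀ i J {r N L G Z m} w A → 1 ≤ Z → N ≡ r + 2 ^ i * 3 ^ J → L ≤ N → N ≤ 2 * L →
    N * m ≤ L * m + N * G → 4 * 2 ^ i * Z * G < m → L ≡ 3 ^ w * A → A ≤ Z → 2 * Z * r < 3 ^ J → L ≡ 2 ^ i * 3 ^ J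
  exact-value i J {r} {N} {L} {G} {Z} {m} w A Z≥1 N≡ L≤N N≤2L close m> L≡ A≤Z 3^J> = trichotomy (<-cmp L B)
    where
    B : ℕ
    B = 2 ^ i * 3 ^ J
    3^J≤B : 3 ^ J ≤ B
    3^J≤B = m≤n*m (3 ^ J) (2 ^ i) {{m^n≢0 2 i}}
    B≤N : B ≤ N
    B≤N = ≤-trans (m≤n+m B r) (≤-reflexive (sym N≡))
    r≤B : r ≤ B
    r≤B = ≤-trans (m≤n*m r (2 * Z) {{m*n≢0 2 Z {{_}} {{>-nonZero Z≥1}}}}) (≤-trans (<⇒≤ 3^J>) 3^J≤B)
    trichotomy : Tri (L < B) (L ≡ B) (B < L) → L ≡ B
    trichotomy (tri≈ _ L≡B _) = L≡B
    trichotomy (tri< L<B _ _) with common-power i J w A Z≥1 A≤Z L≡ (≤-trans 3^J≤B (≤-trans B≤N N≤2L))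
    ... | d , d∣L , d∣B , 3^J≤ = contradiction (begin
      d * m                              ≤⟨ +-cancelˡ-≤ (L * m) (d * m) (N * G) (begin
        L * m + d * m                      ≡⟨ *-distribʳ-+ m L d ⟨
        (L + d) * m                        ≤⟨ *-monoˡ-≤ m (≤-trans (∣-gap d∣L d∣B L<B) B≤N) ⟩
        N * m                              ≤⟨ close ⟩
        L * m + N * G                      ∎) ⟩
      N * G                              ≡⟨ cong (_* G) N≡ ⟩
      (r + B) * G                        ≤⟨ *-monoˡ-≤ G (+-monoˡ-≤ B r≤B) ⟩
      (B + B) * G                        ≡⟨ shuffle (2 ^ i) (3 ^ J) G ⟩
      2 * 2 ^ i * G * 3 ^ J              ≤⟨ *-monoʳ-≤ (2 * 2 ^ i * G) 3^J≤ ⟩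
      2 * 2 ^ i * G * (2 * Z * d)        ≡⟨ shuffle′ (2 ^ i) G Z d ⟩
      d * (4 * 2 ^ i * Z * G)            ∎) (<⇒≱ (*-monoʳ-< d {{>-nonZero d>0}} m>))
      where
      shuffle : ∀ x y g → (x * y + x * y) * g ≡ 2 * x * g * y
      shuffle = solve-∀
      shuffle′ : ∀ x g z d → 2 * x * g * (2 * z * d) ≡ d * (4 * x * z * g)
      shuffle′ = solve-∀
      d>0 : 0 < d
      d>0 = n≢0⇒n>0 λ d≡0 → <⇒≱ (m^n>0 3 J) (≤-trans 3^J≤ (≤-reflexive (trans (cong (2 * Z *_) d≡0) (*-zeroʳ (2 * Z)))))
    -- Here L lies between B and N = r + B, so the common power of 3 would be at most r, too small
    -- once 3 ^ J > 2 Z r. Below B it is the closeness of L to N that fails.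
    trichotomy (tri> _ _ B<L) with common-power i J w A Z≥1 A≤Z L≡ (≤-trans 3^J≤B (≤-trans B≤N N≤2L))
    ... | d , d∣L , d∣B , 3^J≤ = contradiction (≤-trans 3^J≤ (*-monoʳ-≤ (2 * Z) d≤r)) (<⇒≱ 3^J>)
      where
      d≤r : d ≤ r
      d≤r = +-cancelˡ-≤ B d r (≤-trans (∣-gap d∣B d∣L B<L) (≤-trans L≤N (≤-reflexive (trans N≡ (+-comm r B)))))

-- Scales of pruning and the gap above 2 ^ i 3 ^ J

defectBound : ℕ → ℕ
-- 9 ^ i bounds the ratio of an expression for r + 2 ^ i 3 ^ J with at most 2 i + 3 J ones; 8 = 2³
-- pays for passing to a pruned value, which is at least half as large.
defectBound i = 8 * 9 ^ i

-- Rests at scale k are so small that a value within a factor 1 + G / threshold (suc k) of 2 ^ i * 3 ^ J must equal it.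
threshold : ℕ → ℕ → ℕ
threshold i zero    = 8
threshold i (suc k) = 4 * 2 ^ i * restBound (defectBound i) (threshold i k) * defectBound i + threshold i k

opaque
  antitone-≤ : (f : ℕ → ℕ) → (∀ k → f (suc k) ≤ f k) → ∀ k → f k ≤ f 0
  antitone-≤ f anti zero    = ≤-refl
  antitone-≤ f anti (suc k) = ≤-trans (anti k) (antitone-≤ f anti k)

  threshold-mono : ∀ i k → threshold i k ≤ threshold i (suc k)
  threshold-mono i k = m≤n+m (threshold i k) _

  threshold-≥8 : ∀ i k → 8 ≤ threshold i k
  threshold-≥8 i zero    = ≤-refl
  threshold-≥8 i (suc k) = ≤-trans (threshold-≥8 i k) (threshold-mono i k)

  threshold-monotone : ∀ i {k l} → k ≤ l → threshold i k ≤ threshold i l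
  threshold-monotone i {k} k≤l with m≤n⇒∃[o]m+o≡n k≤l
  ... | o , refl = go o
    where
    go : ∀ o → threshold i k ≤ threshold i (k + o)
    go zero    = ≤-reflexive (cong (threshold i) (sym (+-identityʳ k)))
    go (suc o) = ≤-trans (go o) (≤-trans (threshold-mono i (k + o)) (≤-reflexive (cong (threshold i) (sym (+-suc k o)))))

  defectBound-pos : ∀ i → 1 ≤ defectBound i
  defectBound-pos i = *-mono-≤ {1} {8} by-≤? (m^n>0 9 i)

  blockBound-pos : ∀ {G} M → 1 ≤ G → 1 ≤ blockBound G M
  blockBound-pos M G≥1 = *-mono-≤ {1} {suc M} (s≤s z≤n) (*-mono-≤ {1} {8} by-≤? G≥1)

  restBound-pos : ∀ {G} M → 1 ≤ G → 1 ≤ restBound G M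
  restBound-pos {G} M G≥1 = m^n>0 (blockBound G M) {{>-nonZero (blockBound-pos M G≥1)}} (blockBound G M ^ 3 * G)

  n<3^n : ∀ n → n < 3 ^ n
  n<3^n n = <-≤-trans (n<2^n n) (^-monoˡ-≤ n (by-≤? {2} {3}))

  -- At the first scale there are at most G drops, so the count repeats at some k ≤ G. This k
  -- depends on the expression but Q must not, so Q is taken from the last threshold, which
  -- dominates every rest bound that can occur.
  stable-gap : ∀ i → (∀ J e → value e ≡ 2 ^ i * 3 ^ J → 2 * i + 3 * J ≤ ones e) →
    ∀ r j → 1 ≤ r → ∃ λ Q → 1 ≤ Q × (∀ e → value e ≡ r + 2 ^ i * 3 ^ (j + Q) → 2 * i + 3 * (j + Q) < ones e)
  stable-gap i stable r j r≥1 = Q , s≤s z≤n , λ e e≡ → ≰⇒> (no-cheap e e≡)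
    where
    G Q J : ℕ
    G = defectBound i
    Q = suc (2 * threshold i (suc G) * r)
    J = j + Q
    no-cheap : ∀ e → value e ≡ r + 2 ^ i * 3 ^ J → ¬ ones e ≤ 2 * i + 3 * J
    no-cheap e e≡ cheap = <⇒≱ (m<n+m (2 ^ i * 3 ^ J) r≥1) (≤-trans (≤-reflexive (sym e≡)) (≤-trans N≤L (≤-reflexive L≡B)))
      where
      drops : ℕ → ℕ
      drops k = proj₁ (proj₂ (prune (threshold i k) e))
      pruning : ∀ k → Pruned (threshold i k) e (proj₁ (prune (threshold i k) e)) (drops k)
      pruning k = proj₂ (proj₂ (prune (threshold i k) e))
      compare : ∀ k → drops (suc k) ≤ drops k ×
        (drops k ≡ drops (suc k) → proj₁ (prune (threshold i k) e) ≡ proj₁ (prune (threshold i (suc k)) e))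
      compare k = pruned-mono (≤-trans (by-≤? {2} {8}) (threshold-≥8 i k)) (threshold-mono i k) (pruning k) (pruning (suc k))
      3^ones≤ : ∀ {m} → m ≤ ones e → 3 ^ m ≤ 9 ^ i * value e ^ 3
      3^ones≤ {m} m≤ = begin
        3 ^ m                             ≤⟨ ^-monoʳ-≤ 3 (≤-trans m≤ cheap) ⟩
        3 ^ (2 * i + 3 * J)               ≡⟨ ^-distribˡ-+-* 3 (2 * i) (3 * J) ⟩
        3 ^ (2 * i) * 3 ^ (3 * J)         ≡⟨ cong₂ _*_ (^-*-assoc 3 2 i) (cube-3^ J) ⟨
        9 ^ i * (3 ^ J) ^ 3               ≤⟨ *-monoʳ-≤ (9 ^ i) (^-monoˡ-≤ 3 (begin
          3 ^ J                             ≤⟨ m≤n*m (3 ^ J) (2 ^ i) {{m^n≢0 2 i}} ⟩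
          2 ^ i * 3 ^ J                     ≤⟨ m≤n+m (2 ^ i * 3 ^ J) r ⟩
          r + 2 ^ i * 3 ^ J                 ≡⟨ e≡ ⟨
          value e                           ∎)) ⟩
        9 ^ i * value e ^ 3               ∎
      e-defect : Defect≤ G 1 e
      e-defect = ratio (begin
        1 * 3 ^ ones e                    ≡⟨ *-identityˡ (3 ^ ones e) ⟩
        3 ^ ones e                        ≤⟨ 3^ones≤ ≤-refl ⟩
        9 ^ i * value e ^ 3               ≤⟨ *-monoˡ-≤ (value e ^ 3) (m≤n*m (9 ^ i) 8) ⟩
        G * value e ^ 3                   ∎)
      stationary : ∃ λ k → k ≤ G × drops k ≡ drops (suc k)
      stationary = pigeonhole G drops (λ k → proj₁ (compare k)) (drops-≤ (pruning 0) e-defect)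
      k c M M' Z : ℕ
      k = proj₁ stationary
      c = drops k
      M = threshold i k
      M' = threshold i (suc k)
      Z = restBound G M
      p : Expr
      p = proj₁ (prune M e)
      P : Pruned M e p c
      P = pruning k
      -- The same `p` arises at both scales: the coarse M bounds its rest by Z, while the fine M'
      -- makes it close enough to N relative to that Z.
      P' : Pruned M' e p c
      P' = subst₂ (Pruned M' e) (sym (proj₂ (compare k) (proj₂ (proj₂ stationary))))
        (sym (proj₂ (proj₂ stationary))) (pruning (suc k))
      c≤G : c ≤ G
      c≤G = ≤-trans (antitone-≤ drops (λ k → proj₁ (compare k)) k) (drops-≤ (pruning 0) e-defect)
      Z≥1 : 1 ≤ Z
      Z≥1 = restBound-pos M (defectBound-pos i)
      4ZG≤M' : 4 * 2 ^ i * Z * G ≤ M'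
      4ZG≤M' = m≤m+n (4 * 2 ^ i * Z * G) M
      close : value e * suc M' ≤ value p * suc M' + value e * G
      close = ≤-trans (pruned-close P') (+-monoʳ-≤ (value p * suc M') (*-monoʳ-≤ (value e) c≤G))
      4*2^i≥2 : 2 ≤ 4 * 2 ^ i
      4*2^i≥2 = ≤-trans (by-≤? {2} {4}) (*-monoʳ-≤ 4 (m^n>0 2 i))
      N≤2L : value e ≤ 2 * value p
      N≤2L = at-most-double {L = value p} (s≤s z≤n)
        (≤-trans (*-monoˡ-≤ G (≤-trans (≤-reflexive (sym (*-identityʳ 2))) (*-mono-≤ 4*2^i≥2 Z≥1)))
        (≤-trans 4ZG≤M' (n≤1+n M'))) close
      p-defect : Defect≤ G 1 p
      p-defect = ratio (begin
        1 * 3 ^ ones p                    ≡⟨ *-identityˡ (3 ^ ones p) ⟩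
        3 ^ ones p                        ≤⟨ 3^ones≤ (≤-trans (m≤m+n (ones p) c) (pruned-ones P)) ⟩
        9 ^ i * value e ^ 3               ≤⟨ *-monoʳ-≤ (9 ^ i) (^-monoˡ-≤ 3 N≤2L) ⟩
        9 ^ i * (2 * value p) ^ 3         ≡⟨ cong (9 ^ i *_) (cube-* 2 (value p)) ⟩
        9 ^ i * (8 * value p ^ 3)         ≡⟨ shuffle (9 ^ i) (value p ^ 3) ⟩
        G * value p ^ 3                   ∎)
        where
        shuffle : ∀ x y → x * (8 * y) ≡ 8 * x * y
        shuffle = solve-∀
      D : Decomposed (blockBound G M) (ones p) (value p)
      D = pruned-decomposed P p-defect
      3^J> : 2 * Z * r < 3 ^ J
      3^J> = begin-strict
        2 * Z * r                         ≤⟨ *-monoˡ-≤ r (*-monoʳ-≤ 2 Z≤) ⟩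
        2 * threshold i (suc G) * r       <⟨ n<1+n _ ⟩
        Q                                 <⟨ n<3^n Q ⟩
        3 ^ Q                             ≤⟨ ^-monoʳ-≤ 3 (m≤n+m Q j) ⟩
        3 ^ J                             ∎
        where
        Z≤ : Z ≤ threshold i (suc G)
        Z≤ = begin
          Z                               ≤⟨ m≤n*m Z (4 * 2 ^ i) {{>-nonZero (≤-trans (s≤s z≤n) 4*2^i≥2)}} ⟩
          4 * 2 ^ i * Z                   ≤⟨ m≤m*n (4 * 2 ^ i * Z) G {{>-nonZero (defectBound-pos i)}} ⟩
          4 * 2 ^ i * Z * G               ≤⟨ 4ZG≤M' ⟩
          M'                              ≤⟨ threshold-monotone i (s≤s (proj₁ (proj₂ stationary))) ⟩
          threshold i (suc G)             ∎
      L≡B : value p ≡ 2 ^ i * 3 ^ J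
      L≡B = exact-value i J (Decomposed.power D) (Decomposed.rest D) Z≥1 e≡ (pruned-≤ P) N≤2L close (s≤s 4ZG≤M')
        (Decomposed.n≡ D) (rest-bound (blockBound-pos M (defectBound-pos i)) (value-pos p) p-defect D) 3^J>
      c≡0 : c ≡ 0
      c≡0 = n≤0⇒n≡0 (+-cancelˡ-≤ (ones p) c 0 (≤-trans (pruned-ones P)
        (≤-trans cheap (≤-trans (stable J p L≡B) (≤-reflexive (sym (+-identityʳ (ones p))))))))
      N≤L : value e ≤ value p
      N≤L = *-cancelʳ-≤ (value e) (value p) 1 (subst (λ c → value e * M ^ c ≤ value p * suc M ^ c) c≡0 (pruned-≥ P))

-- Explicit expressions and the theorem

two : Expr
two = add one one

double : ℕ → Expr → Expr
double zero    e = e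
double (suc a) e = mul two (double a e)

opaque
  value-double : ∀ a e → value (double a e) ≡ 2 ^ a * value e
  value-double zero    e = sym (+-identityʳ (value e))
  value-double (suc a) e = trans (cong (2 *_) (value-double a e)) (sym (*-assoc 2 (2 ^ a) (value e)))

  ones-double : ∀ a e → ones (double a e) ≡ 2 * a + ones e
  ones-double zero    e = refl
  ones-double (suc a) e = trans (cong (2 +_) (ones-double a e)) (shuffle a (ones e))
    where
    shuffle : ∀ a k → 2 + (2 * a + k) ≡ 2 * (1 + a) + k
    shuffle = solve-∀

  -- The value 1 is excluded because it costs one 1, whereas the formula would give 0.
  smooth-expr : ∀ a c → 2 ≤ 2 ^ a * 3 ^ c → ∃ λ e → value e ≡ 2 ^ a * 3 ^ c × ones e ≡ 2 * a + 3 * c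
  smooth-expr zero zero (s≤s ())
  smooth-expr a (suc c) _ = double a (triple c three) ,
    trans (value-double a (triple c three)) (cong (2 ^ a *_) (trans (value-triple c three) (*-comm (3 ^ c) 3))) ,
    trans (ones-double a (triple c three)) (cong (2 * a +_) (trans (ones-triple c three) (sym (*-suc 3 c))))
  smooth-expr (suc a) zero _ = double a two ,
    trans (value-double a two) (trans (*-comm (2 ^ a) 2) (sym (*-identityʳ (2 * 2 ^ a)))) ,
    trans (ones-double a two) (shuffle a)
    where
    shuffle : ∀ a → 2 * a + 2 ≡ 2 * (1 + a) + 3 * 0
    shuffle = solve-∀

  complexity-3^ : ∀ Q → 1 ≤ Q → IsComplexity (3 ^ Q) (3 * Q)
  complexity-3^ (suc Q) _ = (triple Q three , trans (value-triple Q three) (*-comm (3 ^ Q) 3) ,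
      trans (ones-triple Q three) (sym (*-suc 3 Q))) ,
    λ e e≡ → ≮⇒≥ λ lt → <⇒≱ (^-monoʳ-< 3 (by-≤? {2} {3}) lt)
      (≤-trans (≤-reflexive (trans (sym (cube-3^ (suc Q))) (cong (_^ 3) (sym e≡)))) (cube≤3^ones e))

  complexity-smooth : ∀ i j fb → i ≤ 39 → 2 ≤ 2 ^ i * 3 ^ j → IsComplexity (2 ^ i * 3 ^ j) fb → fb ≡ 2 * i + 3 * j
  complexity-smooth i j fb i≤39 b≥2 ((e , e≡ , ones≡) , least) = ≤-antisym
    (let d , d≡ , d-ones = smooth-expr i j b≥2 in ≤-trans (least d d≡) (≤-reflexive d-ones))
    (≤-trans (smooth-lower e i j i≤39 e≡) (≤-reflexive ones≡))

  exponent-≤39 : ∀ i j → 2 ^ i * 3 ^ j < 10 ^ 12 → i ≤ 39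
  exponent-≤39 i j b< = ≮⇒≥ λ 39<i → <-irrefl refl
    (<-≤-trans b< (≤-trans (by-≤? {10 ^ 12} {2 ^ 40}) (2^≤smooth 40 j 39<i)))

  -- r + b n = r (1 + (b / r) n)
  affine-expr : ∀ {i j r q} → SmoothFactors i j r q → 2 ≤ r → 2 ≤ q → ∀ e →
    ∃ λ d → value d ≡ r + q * r * value e × ones d ≡ 2 * i + 3 * j + 1 + ones e
  affine-expr (smoothFactors a c p s refl refl refl refl) r≥2 q≥2 e
    with smooth-expr a c r≥2 | smooth-expr p s q≥2
  ... | d , d≡ , d-ones | d' , d'≡ , d'-ones = mul d (add one (mul d' e)) ,
    trans (cong₂ (λ x y → x * (1 + y * value e)) d≡ d'≡) (shuffle (2 ^ a * 3 ^ c) (2 ^ p * 3 ^ s) (value e)) ,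
    trans (cong₂ (λ x y → x + (1 + (y + ones e))) d-ones d'-ones) (shuffle′ a c p s (ones e))
    where
    shuffle : ∀ r q n → r * (1 + q * n) ≡ r + q * r * n
    shuffle = solve-∀
    shuffle′ : ∀ a c p s k → 2 * a + 3 * c + (1 + (2 * p + 3 * s + k)) ≡ 2 * (a + p) + 3 * (c + s) + 1 + k
    shuffle′ = solve-∀

open import Data.Integer using (+_)
import Data.Integer as ℤ
import Data.Integer.Properties as ℤ

theorem2p1 : ∀ (i j b r fb : ℕ) → 0 < i + j → b ≡ 2 ^ i * 3 ^ j → b < 10 ^ 12 →
    2 ≤ r → r < b → r ∣ b → IsComplexity b fb →
    IsD b r ((+ fb) Data.Integer.+ (+ 1))
theorem2p1 i j b r fb _ refl b<10¹² r≥2 r<b (divides q b≡) b-complexity = upper , least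
  where
  i≤39 : i ≤ 39
  i≤39 = exponent-≤39 i j b<10¹²
  fb≡ : fb ≡ 2 * i + 3 * j
  fb≡ = complexity-smooth i j fb i≤39 (≤-trans r≥2 (<⇒≤ r<b)) b-complexity
  factors : SmoothFactors i j r q
  factors = smooth-factors i j r q (trans (*-comm r q) (sym b≡))
  -- `r < b` makes the cofactor nontrivial, so r and q both cost what `smooth-expr` says and their
  -- costs add up to f(b).
  q≥2 : 2 ≤ q
  q≥2 = *-cancelʳ-< r 1 q (≤-trans (s≤s (≤-reflexive (*-identityˡ r))) (≤-trans r<b (≤-reflexive b≡)))
  affine : ∀ e → ∃ λ d → value d ≡ r + b * value e × ones d ≡ ones e + (fb + 1)
  affine e = let d , d≡ , d-ones = affine-expr factors r≥2 q≥2 e in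
    d , trans d≡ (cong (λ x → r + x * value e) (sym b≡)) ,
    trans d-ones (trans (cong (λ x → x + 1 + ones e) (sym fb≡)) (+-comm (fb + 1) (ones e)))
  upper : DBound b r (+ fb ℤ.+ + 1)
  upper n _ k m (_ , k-least) ((e , e≡ , e-ones) , _) = let d , d≡ , d-ones = affine e in
    ℤ.+≤+ (≤-trans (k-least d (trans d≡ (cong (λ x → r + b * x) e≡)))
      (≤-reflexive (trans d-ones (cong (_+ (fb + 1)) e-ones))))
  gap : ∃ λ Q → 1 ≤ Q × (∀ e → value e ≡ r + 2 ^ i * 3 ^ (j + Q) → 2 * i + 3 * (j + Q) < ones e)
  gap = stable-gap i (λ J e → smooth-lower e i J i≤39) r j (≤-trans (s≤s z≤n) r≥2)
  -- At n = 3 ^ Q the upper bound is attained: f(n) = 3 Q and f(r + b n) = 3 Q + f(b) + 1.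
  least : ∀ d' → DBound b r d' → + fb ℤ.+ + 1 ℤ.≤ d'
  least d' bounded with gap
  ... | Q , Q≥1 , costly = ℤ.≮⇒≥ λ d'< → ℤ.<⇒≱ (ℤ.+-monoʳ-< (+ (3 * Q)) d'<)
    (bounded (3 ^ Q) (m^n>0 3 Q) (3 * Q + (fb + 1)) (3 * Q) k-complexity (complexity-3^ Q Q≥1))
    where
    k-complexity : IsComplexity (r + b * 3 ^ Q) (3 * Q + (fb + 1))
    k-complexity = (let (e , e≡ , e-ones) , _ = complexity-3^ Q Q≥1
                        d , d≡ , d-ones = affine e
                    in d , trans d≡ (cong (λ x → r + b * x) e≡) , trans d-ones (cong (_+ (fb + 1)) e-ones)) ,
      λ e e≡ → ≤-trans (≤-reflexive cost) (costly e (trans e≡ (cong (λ x → r + x)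
        (trans (*-assoc (2 ^ i) (3 ^ j) (3 ^ Q)) (cong (2 ^ i *_) (sym (^-distribˡ-+-* 3 j Q)))))))
      where
      shuffle : ∀ i j Q → 3 * Q + (2 * i + 3 * j + 1) ≡ 1 + (2 * i + 3 * (j + Q))
      shuffle = solve-∀
      cost : 3 * Q + (fb + 1) ≡ suc (2 * i + 3 * (j + Q))
      cost = trans (cong (λ x → 3 * Q + (x + 1)) fb≡) (shuffle i j Q)
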